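{- Let $0\le\alpha<\tfrac12$ and let $D$ be a distribution on $\{0,1\}^n$ given by a tree BN (every node has at most one parent and the underlying graph is a rooted tree) with all conditional probabilities in $(0,1)$ that is $\alpha$-difference bounded. Then every conjunction $f$ of $d$ literals satisfies $$L_1(f)\le\left(\frac{2-2\alpha}{1-2\alpha}\right)^{2d}.$$
   Context: For a BN with parent sets $\operatorname{pa}(v)$, let $\mu_{v,x_{\operatorname{pa}(v)}}=P(X_v=1\mid X_{\operatorname{pa}(v)}=x_{\operatorname{pa}(v)})$ and $\sigma_{v,x_{\operatorname{pa}(v)}}=\sqrt{\mu_{v,x_{\operatorname{pa}(v)}}(1-\mu_{v,x_{\operatorname{pa}(v)}})}$. The BN is $\alpha$-difference bounded if for every $v$ and every two assignments $x,y$ to $\operatorname{pa}(v)$, $|\mu_{v,x}-\mu_{v,y}|\le\alpha$ and $|\sigma_{v,x}-\sigma_{v,y}|\le\alpha$. The BN-induced basis is $\phi_v(x)=(x_v-\mu_{v,x_{\operatorname{pa}(v)}})/\sigma_{v,x_{\operatorname{pa}(v)}}$, $\phi_S=\prod_{v\in S}\phi_v$; $\hat f_S=\mathbb{E}_D[f(X)\phi_S(X)]$; $L_1(f)=\sum_{S\subseteq[n]}|\hat f_S|$. A conjunction of $d$ literals is $f(x)=\prod_{i\in T_1}x_i\prod_{j\in T_0}(1-x_j)$ with $T_0,T_1$ disjoint and $|T_0\cup T_1|=d$. -}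

module Defs where

open import Algebra.Bundles using (CommutativeRing; CommutativeSemiring)
import Algebra.Definitions.RawSemiring as RawSemiringDefinitions
open import Data.Bool.Base using (Bool; true; false; if_then_else_)
open import Data.Fin.Base using (Fin)
open import Data.Nat.Base as ℕ using (ℕ; zero; suc)
import Data.Nat.Properties as ℕ
open import Data.Integer.Base as ℤ using (-[1+_])
import Data.Integer.Properties as ℤ
open import Data.Product.Base using (∃; _×_; _,_; proj₁; proj₂)
open import Data.Rational.Base as ℚ using (ℚ; 0ℚ; 1ℚ; ½; mkℚ)
import Data.Rational.Properties as ℚ
import Data.Rational.Unnormalised.Base as ℚᵘ
import Data.Rational.Unnormalised.Properties as ℚᵘ
open import Data.Rational.Solver using (module +-*-Solver)
open import Data.Sum.Base using (_⊎_; inj₁; inj₂)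
open import Data.Vec.Base using (Vec; []; _∷_; lookup)
open import Level using (0ℓ)
open import Relation.Binary.Construct.Closure.ReflexiveTransitive using (Star)
open import Relation.Binary.Construct.Closure.Transitive using (TransClosure)
open import Relation.Binary.PropositionalEquality
open import Relation.Nullary using (¬_; yes; no; contradiction)

-- Implicit arguments are often given below because the operations of ℚ unfold on
-- variables, which makes inferring them slow.

module Seq where

  open import Data.Rational.Base
  open ℚ.≤-Reasoning

  ≤-diff : ∀ {p q} d → d ≡ q - p → 0ℚ ≤ d → p ≤ q
  ≤-diff {p} {q} d eq 0≤d = begin
    p            ≡⟨ ℚ.+-identityʳ p ⟨
    p + 0ℚ       ≤⟨ ℚ.+-monoʳ-≤ p 0≤d ⟩
    p + d        ≡⟨ cong (p +_) eq ⟩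
    p + (q - p)  ≡⟨ solve 2 (λ p q → p :+ (q :- p) := q) refl p q ⟩
    q            ∎
    where
    open +-*-Solver

  <-diff : ∀ {p q} d → d ≡ q - p → 0ℚ < d → p < q
  <-diff {p} {q} d eq 0<d = begin-strict
    p            ≡⟨ ℚ.+-identityʳ p ⟨
    p + 0ℚ       <⟨ ℚ.+-monoʳ-< p 0<d ⟩
    p + d        ≡⟨ cong (p +_) eq ⟩
    p + (q - p)  ≡⟨ solve 2 (λ p q → p :+ (q :- p) := q) refl p q ⟩
    q            ∎
    where
    open +-*-Solver

  diff-≤ : ∀ {p q} → p ≤ q → 0ℚ ≤ q - p
  diff-≤ {p} {q} p≤q = begin
    0ℚ     ≡⟨ ℚ.+-inverseʳ p ⟨
    p - p  ≤⟨ ℚ.+-monoˡ-≤ (- p) p≤q ⟩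
    q - p  ∎

  +-nonNeg : ∀ {p q} → 0ℚ ≤ p → 0ℚ ≤ q → 0ℚ ≤ p + q
  +-nonNeg {p} {q} 0≤p 0≤q = ℚ.+-mono-≤ {0ℚ} {p} {0ℚ} {q} 0≤p 0≤q

  +-pos-nonNeg : ∀ {p q} → 0ℚ < p → 0ℚ ≤ q → 0ℚ < p + q
  +-pos-nonNeg {p} {q} 0<p 0≤q = ℚ.+-mono-<-≤ {0ℚ} {p} {0ℚ} {q} 0<p 0≤q

  +-nonNeg-pos : ∀ {p q} → 0ℚ ≤ p → 0ℚ < q → 0ℚ < p + q
  +-nonNeg-pos {p} {q} 0≤p 0<q = ℚ.+-mono-≤-< {0ℚ} {p} {0ℚ} {q} 0≤p 0<q

  +-pos : ∀ {p q} → 0ℚ < p → 0ℚ < q → 0ℚ < p + q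
  +-pos 0<p 0<q = +-pos-nonNeg 0<p (ℚ.<⇒≤ 0<q)

  *-nonNeg : ∀ {p q} → 0ℚ ≤ p → 0ℚ ≤ q → 0ℚ ≤ p * q
  *-nonNeg {p} {q} 0≤p 0≤q = ℚ.nonNegative⁻¹ (p * q)
    {{ℚ.nonNeg*nonNeg⇒nonNeg p {{ℚ.nonNegative 0≤p}} q {{ℚ.nonNegative 0≤q}}}}

  *-pos : ∀ {p q} → 0ℚ < p → 0ℚ < q → 0ℚ < p * q
  *-pos {p} {q} 0<p 0<q = ℚ.positive⁻¹ (p * q)
    {{ℚ.pos*pos⇒pos p {{ℚ.positive 0<p}} q {{ℚ.positive 0<q}}}}

  *-mono-≤ : ∀ {p q r s} → 0ℚ ≤ p → 0ℚ ≤ s → p ≤ q → r ≤ s → p * r ≤ q * s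
  *-mono-≤ {p} {q} {r} {s} 0≤p 0≤s p≤q r≤s = begin
    p * r  ≤⟨ ℚ.*-monoˡ-≤-nonNeg p {{ℚ.nonNegative 0≤p}} r≤s ⟩
    p * s  ≤⟨ ℚ.*-monoʳ-≤-nonNeg s {{ℚ.nonNegative 0≤s}} p≤q ⟩
    q * s  ∎

  0<½ : 0ℚ < ½
  0<½ = ℚ.positive⁻¹ ½

  0<1 : 0ℚ < 1ℚ
  0<1 = ℚ.positive⁻¹ 1ℚ

  half-pos : ∀ {ε} → 0ℚ < ε → 0ℚ < ½ * ε
  half-pos = *-pos 0<½

  half+half : ∀ ε → ½ * ε + ½ * ε ≡ ε
  half+half = solve 1 (λ ε → con ½ :* ε :+ con ½ :* ε := ε) refl
    where
    open +-*-Solver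

  p≤∣p∣ : ∀ p → p ≤ ∣ p ∣
  p≤∣p∣ p with ℚ.≤-total 0ℚ p
  ... | inj₁ 0≤p = ℚ.≤-reflexive (sym (ℚ.0≤p⇒∣p∣≡p 0≤p))
  ... | inj₂ p≤0 = ℚ.≤-trans p≤0 (ℚ.0≤∣p∣ p)

  ∣p∣≤ : ∀ {p q} → p ≤ q → - p ≤ q → ∣ p ∣ ≤ q
  ∣p∣≤ {p} p≤q -p≤q with ℚ.∣p∣≡p∨∣p∣≡-p p
  ... | inj₁ eq rewrite eq = p≤q
  ... | inj₂ eq rewrite eq = -p≤q

  ∣p-q∣≡∣q-p∣ : ∀ p q → ∣ p - q ∣ ≡ ∣ q - p ∣
  ∣p-q∣≡∣q-p∣ p q = trans (sym (ℚ.∣-p∣≡∣p∣ (p - q)))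
    (cong ∣_∣ (solve 2 (λ p q → :- (p :- q) := q :- p) refl p q))
    where
    open +-*-Solver

  triangle : ∀ p q r → ∣ p - r ∣ ≤ ∣ p - q ∣ + ∣ q - r ∣
  triangle p q r = begin
    ∣ p - r ∣              ≡⟨ cong ∣_∣ (solve 3 (λ p q r → p :- r := (p :- q) :+ (q :- r)) refl p q r) ⟩
    ∣ (p - q) + (q - r) ∣  ≤⟨ ℚ.∣p+q∣≤∣p∣+∣q∣ (p - q) (q - r) ⟩
    ∣ p - q ∣ + ∣ q - r ∣  ∎
    where
    open +-*-Solver

  Eventually : (ℕ → Set) → Set
  Eventually P = ∃ λ N → ∀ n → N ℕ.≤ n → P n

  Eventually₂ : (ℕ → ℕ → Set) → Set
  Eventually₂ P = ∃ λ N → ∀ m n → N ℕ.≤ m → N ℕ.≤ n → P m n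

  IsCauchy : (ℕ → ℚ) → Set
  IsCauchy s = ∀ ε → 0ℚ < ε → Eventually₂ λ m n → ∣ s m - s n ∣ ≤ ε

  infixl 3 _⊗_

  _⊗_ : ∀ {P Q} → Eventually P → Eventually Q → Eventually λ n → P n × Q n
  (M , p) ⊗ (N , q) = M ℕ.⊔ N , λ n le →
    p n (ℕ.≤-trans (ℕ.m≤m⊔n M N) le) , q n (ℕ.≤-trans (ℕ.m≤n⊔m M N) le)

  _⊗₂_ : ∀ {P Q} → Eventually₂ P → Eventually₂ Q → Eventually₂ λ m n → P m n × Q m n
  (M , p) ⊗₂ (N , q) = M ℕ.⊔ N , λ m n le le′ →
      p m n (ℕ.≤-trans (ℕ.m≤m⊔n M N) le) (ℕ.≤-trans (ℕ.m≤m⊔n M N) le′)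
    , q m n (ℕ.≤-trans (ℕ.m≤n⊔m M N) le) (ℕ.≤-trans (ℕ.m≤n⊔m M N) le′)

  both : ∀ {P} → Eventually P → Eventually₂ λ m n → P m × P n
  both (N , p) = N , λ m n le le′ → p m le , p n le′

  map₁ : ∀ {P Q : ℕ → Set} → (∀ n → P n → Q n) → Eventually P → Eventually Q
  map₁ f (N , p) = N , λ n le → f n (p n le)

  map₂ : ∀ {P Q : ℕ → ℕ → Set} → (∀ m n → P m n → Q m n) → Eventually₂ P → Eventually₂ Q
  map₂ f (N , p) = N , λ m n le le′ → f m n (p m n le le′)

  ι : ℕ → ℚ
  ι n = ℤ.+ n / 1

  ι-suc : ∀ n → ι (suc n) ≡ 1ℚ + ι n
  ι-suc n = ℚ.toℚᵘ-injective
    (ℚᵘ.≃-trans (ℚ.toℚᵘ-fromℚᵘ (ℚᵘ.mkℚᵘ (ℤ.+ suc n) 0))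
    (ℚᵘ.≃-trans (ℚᵘ.*≡* (cong (ℤ._* ℤ.+ 1) (cong (ℤ._+_ (ℤ.+ 1)) (sym (ℤ.*-identityʳ (ℤ.+ n))))))
    (ℚᵘ.≃-trans (ℚᵘ.+-congʳ ℚᵘ.1ℚᵘ (ℚᵘ.≃-sym (ℚ.toℚᵘ-fromℚᵘ (ℚᵘ.mkℚᵘ (ℤ.+ n) 0))))
    (ℚᵘ.≃-sym (ℚ.toℚᵘ-homo-+ 1ℚ (ι n))))))

  0≤ι : ∀ n → 0ℚ ≤ ι n
  0≤ι zero    = ℚ.≤-refl
  0≤ι (suc n) = subst (0ℚ ≤_) (sym (ι-suc n)) (+-nonNeg (ℚ.<⇒≤ 0<1) (0≤ι n))

  ι-mono : ∀ {m n} → m ℕ.≤ n → ι m ≤ ι n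
  ι-mono {n = n} ℕ.z≤n = 0≤ι n
  ι-mono {suc m} {suc n} (ℕ.s≤s le) =
    subst₂ _≤_ (sym (ι-suc m)) (sym (ι-suc n)) (ℚ.+-monoʳ-≤ 1ℚ (ι-mono le))

  archimedean : ∀ ε → 0ℚ < ε → ∃ λ k → 1ℚ ≤ ε * ι k
  archimedean ε@(mkℚ (ℤ.+ zero) _ _)  0<ε = contradiction (ℚ.positive 0<ε) λ ()
  archimedean ε@(mkℚ -[1+ _ ] _ _)    0<ε = contradiction (ℚ.positive 0<ε) λ ()
  archimedean ε@(mkℚ (ℤ.+ suc p) d _) 0<ε = suc d , ℚ.toℚᵘ-cancel-≤
    (ℚᵘ.≤-respʳ-≃
      (ℚᵘ.≃-trans (ℚᵘ.*-congˡ {toℚᵘ ε} (ℚᵘ.≃-sym (ℚ.toℚᵘ-fromℚᵘ (ℚᵘ.mkℚᵘ (ℤ.+ suc d) 0))))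
                  (ℚᵘ.≃-sym (ℚ.toℚᵘ-homo-* ε (ι (suc d)))))
      (ℚᵘ.*≤* (ℤ.+≤+ le)))
    where
    le : 1 ℕ.* (suc d ℕ.* 1) ℕ.≤ suc p ℕ.* suc d ℕ.* 1
    le = ℕ.≤-trans (ℕ.≤-reflexive (ℕ.*-identityˡ (suc d ℕ.* 1)))
           (ℕ.*-monoˡ-≤ 1 (ℕ.m≤m+n (suc d) (p ℕ.* suc d)))

  ½^_ : ℕ → ℚ
  ½^ zero  = 1ℚ
  ½^ suc n = ½ * ½^ n

  0<½^ : ∀ n → 0ℚ < ½^ n
  0<½^ zero    = 0<1
  0<½^ (suc n) = half-pos (0<½^ n)

  ½^≤1 : ∀ n → ½^ n ≤ 1ℚ
  ½^≤1 zero    = ℚ.≤-refl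
  ½^≤1 (suc n) = ℚ.≤-trans
    (*-mono-≤ {½} {1ℚ} {½^ n} {1ℚ} (ℚ.<⇒≤ 0<½) (ℚ.<⇒≤ 0<1) (≤-diff {½} {1ℚ} ½ refl (ℚ.<⇒≤ 0<½)) (½^≤1 n))
    (ℚ.≤-reflexive (ℚ.*-identityˡ 1ℚ))

  ιn*½^n≤1 : ∀ n → ι n * ½^ n ≤ 1ℚ
  ιn*½^n≤1 zero    = ℚ.≤-trans (ℚ.≤-reflexive (ℚ.*-zeroˡ 1ℚ)) (ℚ.<⇒≤ 0<1)
  ιn*½^n≤1 (suc n) = begin
    ι (suc n) * (½ * ½^ n)          ≡⟨ cong (_* (½ * ½^ n)) (ι-suc n) ⟩
    (1ℚ + ι n) * (½ * ½^ n)
      ≡⟨ solve 2 (λ i h → (con 1ℚ :+ i) :* (con ½ :* h) := con ½ :* (i :* h) :+ con ½ :* h) refl (ι n) (½^ n) ⟩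
    ½ * (ι n * ½^ n) + ½ * ½^ n
      ≤⟨ ℚ.+-mono-≤ (ℚ.*-monoˡ-≤-nonNeg ½ (ιn*½^n≤1 n)) (ℚ.*-monoˡ-≤-nonNeg ½ (½^≤1 n)) ⟩
    ½ * 1ℚ + ½ * 1ℚ                 ≡⟨ half+half 1ℚ ⟩
    1ℚ                              ∎
    where
    open +-*-Solver

  ½^-null : ∀ ε → 0ℚ < ε → Eventually λ n → ½^ n ≤ ε
  ½^-null ε 0<ε with archimedean ε 0<ε
  ... | k , 1≤εk = k , λ n k≤n → begin
    ½^ n                ≡⟨ ℚ.*-identityˡ (½^ n) ⟨
    1ℚ * ½^ n           ≤⟨ *-mono-≤ (ℚ.<⇒≤ 0<1) (ℚ.<⇒≤ (0<½^ n)) (ℚ.≤-trans 1≤εk (ℚ.*-monoˡ-≤-nonNeg ε {{ℚ.nonNegative (ℚ.<⇒≤ 0<ε)}} (ι-mono k≤n))) ℚ.≤-refl ⟩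
    (ε * ι n) * ½^ n    ≡⟨ ℚ.*-assoc ε (ι n) (½^ n) ⟩
    ε * (ι n * ½^ n)    ≤⟨ ℚ.*-monoˡ-≤-nonNeg ε {{ℚ.nonNegative (ℚ.<⇒≤ 0<ε)}} (ιn*½^n≤1 n) ⟩
    ε * 1ℚ              ≡⟨ ℚ.*-identityʳ ε ⟩
    ε                   ∎

  inv : ℚ → ℚ
  inv p with p ℚ.≟ 0ℚ
  ... | yes _   = 0ℚ
  ... | no p≢0 = (1/ p) {{≢-nonZero p≢0}}

  *-inv : ∀ {p} → 0ℚ < p → p * inv p ≡ 1ℚ
  *-inv {p} 0<p with p ℚ.≟ 0ℚ
  ... | yes p≡0 = contradiction (sym p≡0) (ℚ.<⇒≢ 0<p)
  ... | no p≢0  = ℚ.*-inverseʳ p {{≢-nonZero p≢0}}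

  inv-pos : ∀ {p} → 0ℚ < p → 0ℚ < inv p
  inv-pos {p} 0<p = ℚ.≰⇒> λ inv≤0 → ℚ.<-irrefl refl (begin-strict
    0ℚ         <⟨ 0<1 ⟩
    1ℚ         ≡⟨ *-inv 0<p ⟨
    p * inv p  ≤⟨ ℚ.*-monoˡ-≤-nonNeg p {{ℚ.nonNegative (ℚ.<⇒≤ 0<p)}} inv≤0 ⟩
    p * 0ℚ     ≡⟨ ℚ.*-zeroʳ p ⟩
    0ℚ         ∎)

  *-inv-cancel : ∀ {p} → 0ℚ < p → ∀ q → q * inv p * p ≡ q
  *-inv-cancel {p} 0<p q =
    trans (ℚ.*-assoc q (inv p) p)
    (trans (cong (q *_) (trans (ℚ.*-comm (inv p) p) (*-inv 0<p))) (ℚ.*-identityʳ q))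

  ∣const∣ : ∀ {ε} p → 0ℚ < ε → ∣ p - p ∣ ≤ ε
  ∣const∣ p 0<ε = ℚ.≤-trans (ℚ.≤-reflexive (cong ∣_∣ (ℚ.+-inverseʳ p))) (ℚ.<⇒≤ 0<ε)

  +-close : ∀ {ε a b c d} → ∣ a - c ∣ ≤ ½ * ε → ∣ b - d ∣ ≤ ½ * ε → ∣ (a + b) - (c + d) ∣ ≤ ε
  +-close {ε} {a} {b} {c} {d} ac bd = begin
    ∣ (a + b) - (c + d) ∣
      ≡⟨ cong ∣_∣ (solve 4 (λ a b c d → (a :+ b) :- (c :+ d) := (a :- c) :+ (b :- d)) refl a b c d) ⟩
    ∣ (a - c) + (b - d) ∣  ≤⟨ ℚ.∣p+q∣≤∣p∣+∣q∣ (a - c) (b - d) ⟩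
    ∣ a - c ∣ + ∣ b - d ∣  ≤⟨ ℚ.+-mono-≤ ac bd ⟩
    ½ * ε + ½ * ε          ≡⟨ half+half ε ⟩
    ε                      ∎
    where
    open +-*-Solver

  neg-close : ∀ {ε a b} → ∣ a - b ∣ ≤ ε → ∣ - a - - b ∣ ≤ ε
  neg-close {ε} {a} {b} ab = begin
    ∣ - a - - b ∣  ≡⟨ cong ∣_∣ (solve 2 (λ a b → :- a :- :- b := :- (a :- b)) refl a b) ⟩
    ∣ - (a - b) ∣  ≡⟨ ℚ.∣-p∣≡∣p∣ (a - b) ⟩
    ∣ a - b ∣      ≤⟨ ab ⟩
    ε              ∎
    where
    open +-*-Solver

  ∣p∣-∣q∣≤ : ∀ p q → ∣ p ∣ - ∣ q ∣ ≤ ∣ p - q ∣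
  ∣p∣-∣q∣≤ p q = begin
    ∣ p ∣ - ∣ q ∣                   ≡⟨ cong (λ r → ∣ r ∣ - ∣ q ∣) (solve 2 (λ p q → p := (p :- q) :+ q) refl p q) ⟩
    ∣ (p - q) + q ∣ - ∣ q ∣         ≤⟨ ℚ.+-monoˡ-≤ (- ∣ q ∣) (ℚ.∣p+q∣≤∣p∣+∣q∣ (p - q) q) ⟩
    (∣ p - q ∣ + ∣ q ∣) - ∣ q ∣     ≡⟨ solve 2 (λ x y → (x :+ y) :- y := x) refl ∣ p - q ∣ ∣ q ∣ ⟩
    ∣ p - q ∣                       ∎
    where
    open +-*-Solver

  abs-close : ∀ {ε a b} → ∣ a - b ∣ ≤ ε → ∣ ∣ a ∣ - ∣ b ∣ ∣ ≤ ε
  abs-close {ε} {a} {b} ab = ∣p∣≤ (ℚ.≤-trans (∣p∣-∣q∣≤ a b) ab) (begin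
    - (∣ a ∣ - ∣ b ∣)  ≡⟨ solve 2 (λ x y → :- (x :- y) := y :- x) refl ∣ a ∣ ∣ b ∣ ⟩
    ∣ b ∣ - ∣ a ∣      ≤⟨ ∣p∣-∣q∣≤ b a ⟩
    ∣ b - a ∣          ≡⟨ ∣p-q∣≡∣q-p∣ b a ⟩
    ∣ a - b ∣          ≤⟨ ab ⟩
    ε                  ∎)
    where
    open +-*-Solver

  *-close : ∀ {ε B a b c d} → 0ℚ < ε → 0ℚ < B → ∣ b ∣ ≤ B → ∣ c ∣ ≤ B →
            ∣ a - c ∣ ≤ ½ * ε * inv B → ∣ b - d ∣ ≤ ½ * ε * inv B → ∣ a * b - c * d ∣ ≤ ε
  *-close {ε} {B} {a} {b} {c} {d} 0<ε 0<B b≤B c≤B ac bd = begin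
    ∣ a * b - c * d ∣
      ≡⟨ cong ∣_∣ (solve 4 (λ a b c d → a :* b :- c :* d := (a :- c) :* b :+ (b :- d) :* c) refl a b c d) ⟩
    ∣ (a - c) * b + (b - d) * c ∣
      ≤⟨ ℚ.∣p+q∣≤∣p∣+∣q∣ ((a - c) * b) ((b - d) * c) ⟩
    ∣ (a - c) * b ∣ + ∣ (b - d) * c ∣
      ≡⟨ cong₂ _+_ (ℚ.∣p*q∣≡∣p∣*∣q∣ (a - c) b) (ℚ.∣p*q∣≡∣p∣*∣q∣ (b - d) c) ⟩
    ∣ a - c ∣ * ∣ b ∣ + ∣ b - d ∣ * ∣ c ∣
      ≤⟨ ℚ.+-mono-≤ (*-mono-≤ (ℚ.0≤∣p∣ (a - c)) 0≤B ac b≤B) (*-mono-≤ (ℚ.0≤∣p∣ (b - d)) 0≤B bd c≤B) ⟩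
    ½ * ε * inv B * B + ½ * ε * inv B * B
      ≡⟨ cong₂ _+_ (*-inv-cancel 0<B (½ * ε)) (*-inv-cancel 0<B (½ * ε)) ⟩
    ½ * ε + ½ * ε
      ≡⟨ half+half ε ⟩
    ε ∎
    where
    open +-*-Solver
    0≤B = ℚ.<⇒≤ 0<B

  bounded : ∀ s → IsCauchy s → ∃ λ B → 0ℚ < B × Eventually λ n → ∣ s n ∣ ≤ B
  bounded s cs with cs 1ℚ 0<1
  ... | N , close = 1ℚ + ∣ s N ∣ , ℚ.<-≤-trans 0<1 1≤B , N , λ n le → begin
      ∣ s n ∣                    ≡⟨ solve 2 (λ x y → x := (x :- y) :+ y) refl ∣ s n ∣ ∣ s N ∣ ⟩
      (∣ s n ∣ - ∣ s N ∣) + ∣ s N ∣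
        ≤⟨ ℚ.+-monoˡ-≤ ∣ s N ∣ (ℚ.≤-trans (∣p∣-∣q∣≤ (s n) (s N)) (close n N le ℕ.≤-refl)) ⟩
      1ℚ + ∣ s N ∣               ∎
    where
    open +-*-Solver
    1≤B : 1ℚ ≤ 1ℚ + ∣ s N ∣
    1≤B = ℚ.≤-trans (ℚ.≤-reflexive (sym (ℚ.+-identityʳ 1ℚ))) (ℚ.+-monoʳ-≤ 1ℚ (ℚ.0≤∣p∣ (s N)))

  bounded₂ : ∀ s t → IsCauchy s → IsCauchy t →
             ∃ λ B → 0ℚ < B × Eventually λ n → ∣ s n ∣ ≤ B × ∣ t n ∣ ≤ B
  bounded₂ s t cs ct = go (bounded s cs) (bounded t ct)
    where
    go : (∃ λ B → 0ℚ < B × Eventually λ n → ∣ s n ∣ ≤ B) →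
         (∃ λ C → 0ℚ < C × Eventually λ n → ∣ t n ∣ ≤ C) →
         ∃ λ D → 0ℚ < D × Eventually λ n → ∣ s n ∣ ≤ D × ∣ t n ∣ ≤ D
    go (B , 0<B , s≤B) (C , 0<C , t≤C) =
        B + C
      , +-pos {B} {C} 0<B 0<C
      , map₁ (λ n (p , q) → ℚ.≤-trans p B≤ , ℚ.≤-trans q C≤) (s≤B ⊗ t≤C)
      where
      B≤ : B ≤ B + C
      B≤ = ℚ.≤-trans (ℚ.≤-reflexive (sym (ℚ.+-identityʳ B))) (ℚ.+-monoʳ-≤ B (ℚ.<⇒≤ 0<C))
      C≤ : C ≤ B + C
      C≤ = ℚ.≤-trans (ℚ.≤-reflexive (sym (ℚ.+-identityˡ C))) (ℚ.+-monoˡ-≤ C (ℚ.<⇒≤ 0<B))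

  const-cauchy : ∀ p → IsCauchy λ _ → p
  const-cauchy p ε 0<ε = 0 , λ _ _ _ _ → ∣const∣ p 0<ε

  +-cauchy : ∀ {s t} → IsCauchy s → IsCauchy t → IsCauchy λ n → s n + t n
  +-cauchy {s} {t} cs ct ε 0<ε =
    map₂ (λ m n (p , q) → +-close {ε} {s m} {t m} {s n} {t n} p q) (cs (½ * ε) (half-pos 0<ε) ⊗₂ ct (½ * ε) (half-pos 0<ε))

  neg-cauchy : ∀ {s} → IsCauchy s → IsCauchy λ n → - s n
  neg-cauchy {s} cs ε 0<ε = map₂ (λ m n → neg-close {ε} {s m} {s n}) (cs ε 0<ε)

  abs-cauchy : ∀ {s} → IsCauchy s → IsCauchy λ n → ∣ s n ∣
  abs-cauchy {s} cs ε 0<ε = map₂ (λ m n → abs-close {ε} {s m} {s n}) (cs ε 0<ε)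

  *-cauchy : ∀ {s t} → IsCauchy s → IsCauchy t → IsCauchy λ n → s n * t n
  *-cauchy {s} {t} cs ct ε 0<ε = go (bounded₂ s t cs ct)
    where
    go : (∃ λ B → 0ℚ < B × Eventually λ n → ∣ s n ∣ ≤ B × ∣ t n ∣ ≤ B) →
         Eventually₂ λ m n → ∣ s m * t m - s n * t n ∣ ≤ ε
    go (B , 0<B , bnd) = map₂
      (λ m n ((p , q) , ((_ , tm≤B) , (sn≤B , _))) →
        *-close {ε} {B} {s m} {t m} {s n} {t n} 0<ε 0<B tm≤B sn≤B p q)
      ((cs δ 0<δ ⊗₂ ct δ 0<δ) ⊗₂ both bnd)
      where
      δ = ½ * ε * inv B
      0<δ : 0ℚ < δ
      0<δ = *-pos {½ * ε} {inv B} (half-pos 0<ε) (inv-pos 0<B)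

  inv-cauchy : ∀ {s δ} → 0ℚ < δ → Eventually (λ n → δ ≤ s n) → IsCauchy s → IsCauchy λ n → inv (s n)
  inv-cauchy {s} {δ} 0<δ δ≤s cs ε 0<ε = map₂
    (λ m n (p , (δ≤a , δ≤b)) → close (s m) (s n) δ≤a δ≤b p)
    (cs (ε * (δ * δ)) (*-pos 0<ε (*-pos 0<δ 0<δ)) ⊗₂ both δ≤s)
    where
    open +-*-Solver
    D = inv δ
    inv≤D : ∀ a → δ ≤ a → inv a ≤ D
    inv≤D a δ≤a = begin
      inv a              ≡⟨ *-inv-cancel 0<δ (inv a) ⟨
      inv a * D * δ      ≤⟨ ℚ.*-monoˡ-≤-nonNeg (inv a * D) {{ℚ.nonNegative (ℚ.<⇒≤ (*-pos (inv-pos 0<a) (inv-pos 0<δ)))}} δ≤a ⟩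
      inv a * D * a      ≡⟨ solve 3 (λ i d a → i :* d :* a := d :* i :* a) refl (inv a) D a ⟩
      D * inv a * a      ≡⟨ *-inv-cancel 0<a D ⟩
      D                  ∎
      where 0<a = ℚ.<-≤-trans 0<δ δ≤a
    close : ∀ a b → δ ≤ a → δ ≤ b → ∣ a - b ∣ ≤ ε * (δ * δ) → ∣ inv a - inv b ∣ ≤ ε
    close a b δ≤a δ≤b ab = begin
      ∣ inv a - inv b ∣
        ≡⟨ cong₂ (λ x y → ∣ x - y ∣) (sym (*-inv-cancel 0<b (inv a))) (sym (*-inv-cancel 0<a (inv b))) ⟩
      ∣ inv a * inv b * b - inv b * inv a * a ∣
        ≡⟨ cong ∣_∣ (solve 4 (λ i j a b → i :* j :* b :- j :* i :* a := i :* j :* (b :- a)) refl (inv a) (inv b) a b) ⟩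
      ∣ inv a * inv b * (b - a) ∣
        ≡⟨ ℚ.∣p*q∣≡∣p∣*∣q∣ (inv a * inv b) (b - a) ⟩
      ∣ inv a * inv b ∣ * ∣ b - a ∣
        ≡⟨ cong₂ _*_ (ℚ.0≤p⇒∣p∣≡p (ℚ.<⇒≤ 0<ij)) (∣p-q∣≡∣q-p∣ b a) ⟩
      inv a * inv b * ∣ a - b ∣
        ≤⟨ *-mono-≤ (ℚ.<⇒≤ 0<ij) (ℚ.<⇒≤ (*-pos 0<ε (*-pos 0<δ 0<δ)))
             (*-mono-≤ (ℚ.<⇒≤ (inv-pos 0<a)) (ℚ.<⇒≤ (inv-pos 0<δ)) (inv≤D a δ≤a) (inv≤D b δ≤b)) ab ⟩
      D * D * (ε * (δ * δ))
        ≡⟨ solve 3 (λ d e x → d :* d :* (e :* (x :* x)) := e :* d :* x :* d :* x) refl D ε δ ⟩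
      ε * D * δ * D * δ
        ≡⟨ *-inv-cancel 0<δ (ε * D * δ) ⟩
      ε * D * δ
        ≡⟨ *-inv-cancel 0<δ ε ⟩
      ε ∎
      where
      0<a = ℚ.<-≤-trans 0<δ δ≤a
      0<b = ℚ.<-≤-trans 0<δ δ≤b
      0<ij = *-pos (inv-pos 0<a) (inv-pos 0<b)

  -- bisect q n encloses √(max q 0) in an interval of length (1 + ∣ q ∣) / 2ⁿ.

  step : ℚ → ℚ × ℚ → ℚ × ℚ
  step q (lo , hi) with (½ * (lo + hi)) * (½ * (lo + hi)) ℚ.≤? q
  ... | yes _ = ½ * (lo + hi) , hi
  ... | no _  = lo , ½ * (lo + hi)

  bisect : ℚ → ℕ → ℚ × ℚ
  bisect q zero    = 0ℚ , 1ℚ + ∣ q ∣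
  bisect q (suc n) = step q (bisect q n)

  record Invariant (q : ℚ) (n : ℕ) (lo hi : ℚ) : Set where
    field
      0≤lo  : 0ℚ ≤ lo
      lo²≤q : lo ≡ 0ℚ ⊎ lo * lo ≤ q
      q<hi² : q < hi * hi
      hi≤   : hi ≤ 1ℚ + ∣ q ∣
      width : hi - lo ≡ ½^ n * (1ℚ + ∣ q ∣)

    0<w : 0ℚ < hi - lo
    0<w = subst (0ℚ <_) (sym width) (*-pos (0<½^ n) (+-pos-nonNeg 0<1 (ℚ.0≤∣p∣ q)))

    lo≤hi : lo ≤ hi
    lo≤hi = ≤-diff (hi - lo) refl (ℚ.<⇒≤ 0<w)

  bisect-invariant : ∀ q n → Invariant q n (proj₁ (bisect q n)) (proj₂ (bisect q n))
  bisect-invariant q zero = record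
    { 0≤lo  = ℚ.≤-refl
    ; lo²≤q = inj₁ refl
    ; q<hi² = begin-strict
        q                                ≤⟨ p≤∣p∣ q ⟩
        ∣ q ∣                            <⟨ <-diff (1ℚ + ∣ q ∣ * ∣ q ∣ + ∣ q ∣)
                                             (solve 1 (λ a → con 1ℚ :+ a :* a :+ a := (con 1ℚ :+ a) :* (con 1ℚ :+ a) :- a) refl ∣ q ∣)
                                             (+-pos-nonNeg (+-pos-nonNeg 0<1 (*-nonNeg (ℚ.0≤∣p∣ q) (ℚ.0≤∣p∣ q))) (ℚ.0≤∣p∣ q)) ⟩
        (1ℚ + ∣ q ∣) * (1ℚ + ∣ q ∣)      ∎
    ; hi≤   = ℚ.≤-refl
    ; width = solve 1 (λ a → (con 1ℚ :+ a) :- con 0ℚ := con 1ℚ :* (con 1ℚ :+ a)) refl ∣ q ∣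
    }
    where
    open +-*-Solver
  bisect-invariant q (suc n) with bisect q n | bisect-invariant q n
  ... | lo , hi | inv with (½ * (lo + hi)) * (½ * (lo + hi)) ℚ.≤? q
  ... | yes m²≤q = record
    { 0≤lo  = *-nonNeg (ℚ.<⇒≤ 0<½) (+-nonNeg 0≤lo (ℚ.≤-trans 0≤lo lo≤hi))
    ; lo²≤q = inj₂ m²≤q
    ; q<hi² = q<hi²
    ; hi≤   = hi≤
    ; width = trans (solve 2 (λ l h → h :- con ½ :* (l :+ h) := con ½ :* (h :- l)) refl lo hi)
                    (trans (cong (½ *_) width) (sym (ℚ.*-assoc ½ (½^ n) (1ℚ + ∣ q ∣))))
    }
    where
    open Invariant inv
    open +-*-Solver
  ... | no m²≰q = record
    { 0≤lo  = 0≤lo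
    ; lo²≤q = lo²≤q
    ; q<hi² = ℚ.≰⇒> m²≰q
    ; hi≤   = ℚ.≤-trans (≤-diff (½ * (hi - lo))
                (solve 2 (λ l h → con ½ :* (h :- l) := h :- con ½ :* (l :+ h)) refl lo hi)
                (ℚ.<⇒≤ (half-pos 0<w))) hi≤
    ; width = trans (solve 2 (λ l h → con ½ :* (l :+ h) :- l := con ½ :* (h :- l)) refl lo hi)
                    (trans (cong (½ *_) width) (sym (ℚ.*-assoc ½ (½^ n) (1ℚ + ∣ q ∣))))
    }
    where
    open Invariant inv
    open +-*-Solver

  lower upper : (ℕ → ℚ) → ℕ → ℚ
  lower s n = proj₁ (bisect (s n) n)
  upper s n = proj₂ (bisect (s n) n)

  lower-upper : ∀ {s} → IsCauchy s → ∀ ε → 0ℚ < ε → Eventually λ n → upper s n ≤ lower s n + ε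
  lower-upper {s} cs ε 0<ε = go (bounded s cs)
    where
    open +-*-Solver
    go : (∃ λ B → 0ℚ < B × Eventually λ n → ∣ s n ∣ ≤ B) →
         Eventually λ n → upper s n ≤ lower s n + ε
    go (B , 0<B , s≤B) = map₁
      (λ n (h≤ , sn≤B) → let open Invariant (bisect-invariant (s n) n) in begin
        upper s n                            ≡⟨ solve 2 (λ l h → h := l :+ (h :- l)) refl (lower s n) (upper s n) ⟩
        lower s n + (upper s n - lower s n)  ≡⟨ cong (lower s n +_) width ⟩
        lower s n + ½^ n * (1ℚ + ∣ s n ∣)
          ≤⟨ ℚ.+-monoʳ-≤ (lower s n) (*-mono-≤ (ℚ.<⇒≤ (0<½^ n)) (ℚ.<⇒≤ 0<1+B) h≤ (ℚ.+-monoʳ-≤ 1ℚ sn≤B)) ⟩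
        lower s n + ε * inv (1ℚ + B) * (1ℚ + B)  ≡⟨ cong (lower s n +_) (*-inv-cancel 0<1+B ε) ⟩
        lower s n + ε                        ∎)
      (½^-null (ε * inv (1ℚ + B)) (*-pos 0<ε (inv-pos 0<1+B)) ⊗ s≤B)
      where
      0<1+B : 0ℚ < 1ℚ + B
      0<1+B = +-pos {1ℚ} {B} 0<1 0<B

  sqrt-cauchy : ∀ {s} → IsCauchy s → IsCauchy (lower s)
  sqrt-cauchy {s} cs ε 0<ε = map₂
    (λ m n (d , (um , un)) →
      ∣p∣≤ (sub (one-sided n m un (ℚ.≤-trans (p≤∣p∣ (s m - s n)) d)))
           (ℚ.≤-trans
             (ℚ.≤-reflexive (solve 2 (λ x y → :- (x :- y) := y :- x) refl (lower s m) (lower s n)))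
             (sub (one-sided m n um
               (ℚ.≤-trans (p≤∣p∣ (s n - s m)) (ℚ.≤-trans (ℚ.≤-reflexive (∣p-q∣≡∣q-p∣ (s n) (s m))) d))))))
    (cs (δ * δ) (*-pos 0<δ 0<δ) ⊗₂ both (lower-upper cs δ 0<δ))
    where
    open +-*-Solver
    δ = ½ * ε
    0<δ = half-pos 0<ε
    sub : ∀ {x y} → x ≤ y + ε → x - y ≤ ε
    sub {x} {y} le = ≤-diff ((y + ε) - x) (solve 3 (λ x y e → (y :+ e) :- x := e :- (x :- y)) refl x y ε) (diff-≤ le)
    one-sided : ∀ m n → upper s m ≤ lower s m + δ → s n - s m ≤ δ * δ → lower s n ≤ lower s m + ε
    one-sided m n um d = ℚ.≮⇒≥ λ lt → go lt (Invariant.lo²≤q In)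
      where
      Im = bisect-invariant (s m) m
      In = bisect-invariant (s n) n
      l = lower s m
      h = upper s m
      t = lower s n
      0≤h : 0ℚ ≤ h
      0≤h = ℚ.≤-trans (Invariant.0≤lo Im) (Invariant.lo≤hi Im)
      go : l + ε < t → ¬ (t ≡ 0ℚ ⊎ t * t ≤ s n)
      go lt (inj₁ t≡0) = ℚ.<-irrefl refl (begin-strict
        0ℚ      <⟨ +-nonNeg-pos (Invariant.0≤lo Im) 0<ε ⟩
        l + ε   <⟨ lt ⟩
        t       ≡⟨ t≡0 ⟩
        0ℚ      ∎)
      go lt (inj₂ t²≤) = ℚ.<-irrefl refl (begin-strict
        s n                        ≡⟨ solve 2 (λ x y → x := (x :- y) :+ y) refl (s n) (s m) ⟩
        (s n - s m) + s m          ≤⟨ ℚ.+-monoˡ-≤ (s m) d ⟩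
        δ * δ + s m                <⟨ ℚ.+-monoʳ-< (δ * δ) (Invariant.q<hi² Im) ⟩
        δ * δ + h * h
          ≤⟨ ≤-diff (h * δ + h * δ) (solve 2 (λ h d → h :* d :+ h :* d := (h :+ d) :* (h :+ d) :- (d :* d :+ h :* h)) refl h δ)
               (+-nonNeg (*-nonNeg 0≤h (ℚ.<⇒≤ 0<δ)) (*-nonNeg 0≤h (ℚ.<⇒≤ 0<δ))) ⟩
        (h + δ) * (h + δ)          ≤⟨ *-mono-≤ (+-nonNeg 0≤h (ℚ.<⇒≤ 0<δ)) (Invariant.0≤lo In) h+δ≤t h+δ≤t ⟩
        t * t                      ≤⟨ t²≤ ⟩
        s n                        ∎)
        where
        h+δ≤t : h + δ ≤ t
        h+δ≤t = begin
          h + δ            ≤⟨ ℚ.+-monoˡ-≤ δ um ⟩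
          (l + δ) + δ      ≡⟨ ℚ.+-assoc l δ δ ⟩
          l + (δ + δ)      ≡⟨ cong (l +_) (half+half ε) ⟩
          l + ε            <⟨ lt ⟩
          t                ∎

  sqrt-pos : ∀ {s δ} → IsCauchy s → 0ℚ < δ → Eventually (λ n → δ ≤ s n) →
             ∃ λ γ → 0ℚ < γ × Eventually λ n → γ ≤ lower s n
  sqrt-pos {s} {δ} cs 0<δ δ≤s = go root
    where
    open +-*-Solver
    root : ∃ λ γ → 0ℚ < γ × γ * γ ≤ δ
    root = choose (ℚ.≤-total δ 1ℚ)
      where
      choose : δ ≤ 1ℚ ⊎ 1ℚ ≤ δ → ∃ λ γ → 0ℚ < γ × γ * γ ≤ δ
      choose (inj₁ δ≤1) = δ , 0<δ , ℚ.≤-trans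
        (*-mono-≤ (ℚ.<⇒≤ 0<δ) (ℚ.<⇒≤ 0<1) ℚ.≤-refl δ≤1) (ℚ.≤-reflexive (ℚ.*-identityʳ δ))
      choose (inj₂ 1≤δ) = 1ℚ , 0<1 , ℚ.≤-trans (ℚ.≤-reflexive (ℚ.*-identityˡ 1ℚ)) 1≤δ
    go : (∃ λ γ → 0ℚ < γ × γ * γ ≤ δ) → ∃ λ γ → 0ℚ < γ × Eventually λ n → γ ≤ lower s n
    go (γ , 0<γ , γ²≤δ) = ½ * γ , half-pos 0<γ , map₁
      (λ n (un , δ≤) → ≤-diff ((lower s n + ½ * γ) - γ) (shuffle (lower s n))
        (diff-≤ (ℚ.≤-trans (ℚ.<⇒≤ (γ<upper n δ≤)) un)))
      (lower-upper cs (½ * γ) (half-pos 0<γ) ⊗ δ≤s)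
      where
      shuffle : ∀ l → (l + ½ * γ) - γ ≡ l - ½ * γ
      shuffle l = solve 2 (λ l g → (l :+ con ½ :* g) :- g := l :- con ½ :* g) refl l γ
      γ<upper : ∀ n → δ ≤ s n → γ < upper s n
      γ<upper n δ≤ = ℚ.≰⇒> λ u≤γ → ℚ.<-irrefl refl (begin-strict
        s n                    <⟨ q<hi² ⟩
        upper s n * upper s n  ≤⟨ *-mono-≤ (ℚ.≤-trans 0≤lo lo≤hi) (ℚ.<⇒≤ 0<γ) u≤γ u≤γ ⟩
        γ * γ                  ≤⟨ γ²≤δ ⟩
        δ                      ≤⟨ δ≤ ⟩
        s n                    ∎)
        where
        open Invariant (bisect-invariant (s n) n)

  sqrt-square : ∀ {s} → IsCauchy s → (∀ ε → 0ℚ < ε → Eventually λ n → 0ℚ ≤ s n + ε) →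
                ∀ ε → 0ℚ < ε → Eventually λ n → ∣ lower s n * lower s n - s n ∣ ≤ ε
  sqrt-square {s} cs 0≤s ε 0<ε = go (bounded s cs)
    where
    open +-*-Solver
    go : (∃ λ B → 0ℚ < B × Eventually λ n → ∣ s n ∣ ≤ B) →
         Eventually λ n → ∣ lower s n * lower s n - s n ∣ ≤ ε
    go (B , 0<B , s≤B) = map₁ close (lower-upper cs δ 0<δ ⊗ s≤B ⊗ 0≤s ε 0<ε)
      where
      C = (1ℚ + B) + (1ℚ + B)
      0<1+B : 0ℚ < 1ℚ + B
      0<1+B = +-pos {1ℚ} {B} 0<1 0<B
      0<C : 0ℚ < C
      0<C = +-pos {1ℚ + B} {1ℚ + B} 0<1+B 0<1+B
      δ = ε * inv C
      0<δ : 0ℚ < δ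
      0<δ = *-pos 0<ε (inv-pos 0<C)
      close : ∀ n → (upper s n ≤ lower s n + δ × ∣ s n ∣ ≤ B) × 0ℚ ≤ s n + ε →
              ∣ lower s n * lower s n - s n ∣ ≤ ε
      close n ((un , sn≤B) , nn) = ∣p∣≤ (above lo²≤q) below
        where
        open Invariant (bisect-invariant (s n) n)
        l = lower s n
        h = upper s n
        h≤1+B : h ≤ 1ℚ + B
        h≤1+B = ℚ.≤-trans hi≤ (ℚ.+-monoʳ-≤ 1ℚ sn≤B)
        above : l ≡ 0ℚ ⊎ l * l ≤ s n → l * l - s n ≤ ε
        above (inj₁ l≡0) = begin
          l * l - s n      ≡⟨ cong (λ l → l * l - s n) l≡0 ⟩
          0ℚ * 0ℚ - s n
            ≤⟨ ≤-diff (s n + ε) (solve 2 (λ q e → q :+ e := e :- (con 0ℚ :* con 0ℚ :- q)) refl (s n) ε) nn ⟩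
          ε                ∎
        above (inj₂ le) = ≤-diff ((s n - l * l) + ε)
          (solve 3 (λ q l e → (q :- l :* l) :+ e := e :- (l :* l :- q)) refl (s n) l ε)
          (+-nonNeg (diff-≤ le) (ℚ.<⇒≤ 0<ε))
        below : - (l * l - s n) ≤ ε
        below = begin
          - (l * l - s n)      ≡⟨ solve 2 (λ l q → :- (l :* l :- q) := q :- l :* l) refl l (s n) ⟩
          s n - l * l          ≤⟨ ℚ.+-monoˡ-≤ (- (l * l)) (ℚ.<⇒≤ q<hi²) ⟩
          h * h - l * l        ≡⟨ solve 2 (λ l h → h :* h :- l :* l := (h :- l) :* (h :+ l)) refl l h ⟩
          (h - l) * (h + l)
            ≤⟨ *-mono-≤ {h - l} {δ} {h + l} {C} (ℚ.<⇒≤ 0<w) (ℚ.<⇒≤ 0<C)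
                 (≤-diff ((l + δ) - h) (solve 3 (λ l d h → (l :+ d) :- h := d :- (h :- l)) refl l δ h) (diff-≤ un))
                 (ℚ.+-mono-≤ h≤1+B (ℚ.≤-trans lo≤hi h≤1+B)) ⟩
          δ * C                ≡⟨ *-inv-cancel 0<C ε ⟩
          ε                    ∎

-- Real numbers are Cauchy sequences of rationals, with _≈_ as their equality.

record ℝ : Set where
  no-eta-equality
  field
    seq    : ℕ → ℚ
    cauchy : Seq.IsCauchy seq

open ℝ

infix 4 _≈_ _≤_ _<_

record _≈_ (x y : ℝ) : Set where
  constructor mk≈
  field
    close : ∀ ε → 0ℚ ℚ.< ε → Seq.Eventually λ n → ℚ.∣ seq x n ℚ.- seq y n ∣ ℚ.≤ ε

record _≤_ (x y : ℝ) : Set where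
  constructor mk≤
  field
    below : ∀ ε → 0ℚ ℚ.< ε → Seq.Eventually λ n → seq x n ℚ.≤ seq y n ℚ.+ ε

record _<_ (x y : ℝ) : Set where
  constructor mk<
  field
    gap       : ℚ
    gap-pos   : 0ℚ ℚ.< gap
    separated : Seq.Eventually λ n → seq x n ℚ.+ gap ℚ.≤ seq y n

infixl 6 _+_ _-_
infixl 7 _*_ _/_[_]
infix  8 -_

fromℚ : ℚ → ℝ
seq    (fromℚ p) _ = p
cauchy (fromℚ p)   = Seq.const-cauchy p

0ℝ 1ℝ 2ℝ ½ℝ : ℝ
0ℝ = fromℚ 0ℚ
1ℝ = fromℚ 1ℚ
2ℝ = fromℚ (1ℚ ℚ.+ 1ℚ)
½ℝ = fromℚ ½

_+_ : ℝ → ℝ → ℝ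
seq    (x + y) n = seq x n ℚ.+ seq y n
cauchy (x + y)   = Seq.+-cauchy {seq x} {seq y} (cauchy x) (cauchy y)

-_ : ℝ → ℝ
seq    (- x) n = ℚ.- seq x n
cauchy (- x)   = Seq.neg-cauchy {seq x} (cauchy x)

_-_ : ℝ → ℝ → ℝ
x - y = x + - y

_*_ : ℝ → ℝ → ℝ
seq    (x * y) n = seq x n ℚ.* seq y n
cauchy (x * y)   = Seq.*-cauchy {seq x} {seq y} (cauchy x) (cauchy y)

abs : ℝ → ℝ
seq    (abs x) n = ℚ.∣ seq x n ∣
cauchy (abs x)   = Seq.abs-cauchy {seq x} (cauchy x)

0<⇒separated : ∀ {x} (0<x : 0ℝ < x) → Seq.Eventually λ n → _<_.gap 0<x ℚ.≤ seq x n
0<⇒separated {x} (mk< δ _ ev) =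
  Seq.map₁ (λ n → subst (ℚ._≤ seq x n) (ℚ.+-identityˡ δ)) ev

separated⇒0< : ∀ {x} δ → 0ℚ ℚ.< δ → Seq.Eventually (λ n → δ ℚ.≤ seq x n) → 0ℝ < x
separated⇒0< {x} δ 0<δ ev =
  mk< δ 0<δ (Seq.map₁ (λ n → subst (ℚ._≤ seq x n) (sym (ℚ.+-identityˡ δ))) ev)

recip : (x : ℝ) → 0ℝ < x → ℝ
seq    (recip x 0<x) n = Seq.inv (seq x n)
cauchy (recip x 0<x)   = Seq.inv-cauchy {seq x} (_<_.gap-pos 0<x) (0<⇒separated 0<x) (cauchy x)

_/_[_] : (x y : ℝ) → 0ℝ < y → ℝ
x / y [ 0<y ] = x * recip y 0<y

-- sqrt x is 0ℝ for negative x.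

sqrt : ℝ → ℝ
seq    (sqrt x) = Seq.lower (seq x)
cauchy (sqrt x) = Seq.sqrt-cauchy {seq x} (cauchy x)

*-recip : ∀ x (0<x : 0ℝ < x) → x * recip x 0<x ≈ 1ℝ
*-recip x 0<x = mk≈ λ ε 0<ε → Seq.map₁
  (λ n δ≤x → subst (λ p → ℚ.∣ p ℚ.- 1ℚ ∣ ℚ.≤ ε)
    (sym (Seq.*-inv (ℚ.<-≤-trans (_<_.gap-pos 0<x) δ≤x))) (Seq.∣const∣ 1ℚ 0<ε))
  (0<⇒separated 0<x)

0≤sqrt : ∀ x → 0ℝ ≤ sqrt x
0≤sqrt x = mk≤ λ ε 0<ε → 0 , λ n _ → Seq.+-nonNeg
  (Seq.Invariant.0≤lo (Seq.bisect-invariant (seq x n) n)) (ℚ.<⇒≤ 0<ε)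

sqrt-*-sqrt : ∀ x → 0ℝ ≤ x → sqrt x * sqrt x ≈ x
sqrt-*-sqrt x (mk≤ 0≤x) = mk≈ (Seq.sqrt-square {seq x} (cauchy x) 0≤x)

0<sqrt : ∀ x → 0ℝ < x → 0ℝ < sqrt x
0<sqrt x 0<x = go (Seq.sqrt-pos {seq x} (cauchy x) (_<_.gap-pos 0<x) (0<⇒separated 0<x))
  where
  go : (∃ λ γ → 0ℚ ℚ.< γ × Seq.Eventually λ n → γ ℚ.≤ Seq.lower (seq x) n) → 0ℝ < sqrt x
  go (γ , 0<γ , ev) = separated⇒0< {sqrt x} γ 0<γ ev

0<* : ∀ x y → 0ℝ < x → 0ℝ < y → 0ℝ < x * y
0<* x y 0<x 0<y = separated⇒0< {x * y} (_<_.gap 0<x ℚ.* _<_.gap 0<y)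
  (Seq.*-pos {_<_.gap 0<x} {_<_.gap 0<y} (_<_.gap-pos 0<x) (_<_.gap-pos 0<y))
  (Seq.map₁ (λ n (p , q) → Seq.*-mono-≤ {_<_.gap 0<x} {seq x n} {_<_.gap 0<y} {seq y n}
      (ℚ.<⇒≤ (_<_.gap-pos 0<x)) (ℚ.<⇒≤ (ℚ.<-≤-trans (_<_.gap-pos 0<y) q)) p q)
    (0<⇒separated 0<x Seq.⊗ 0<⇒separated 0<y))

x<y⇒0<y-x : ∀ x y → x < y → 0ℝ < y - x
x<y⇒0<y-x x y (mk< δ 0<δ ev) = separated⇒0< {y - x} δ 0<δ
  (Seq.map₁ (λ n le → Seq.≤-diff {δ} {seq y n ℚ.- seq x n} (seq y n ℚ.- (seq x n ℚ.+ δ))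
    (solve 3 (λ x y d → y :- (x :+ d) := (y :- x) :- d) refl (seq x n) (seq y n) δ)
    (Seq.diff-≤ le)) ev)
  where
  open +-*-Solver

x<½⇒0<1-2x : ∀ x → x < ½ℝ → 0ℝ < 1ℝ - 2ℝ * x
x<½⇒0<1-2x x (mk< δ 0<δ ev) = separated⇒0< {1ℝ - 2ℝ * x} δ 0<δ
  (Seq.map₁ (λ n le → Seq.≤-diff {δ} {1ℚ ℚ.- (1ℚ ℚ.+ 1ℚ) ℚ.* seq x n} ((½ ℚ.- (seq x n ℚ.+ δ)) ℚ.+ (½ ℚ.- (seq x n ℚ.+ δ)) ℚ.+ δ)
    (solve 2 (λ x d → (con ½ :- (x :+ d)) :+ (con ½ :- (x :+ d)) :+ d
                        := (con 1ℚ :- con (1ℚ ℚ.+ 1ℚ) :* x) :- d) refl (seq x n) δ)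
    (Seq.+-nonNeg {½ ℚ.- (seq x n ℚ.+ δ) ℚ.+ (½ ℚ.- (seq x n ℚ.+ δ))} {δ}
      (Seq.+-nonNeg {½ ℚ.- (seq x n ℚ.+ δ)} {½ ℚ.- (seq x n ℚ.+ δ)} (Seq.diff-≤ le) (Seq.diff-≤ le))
      (ℚ.<⇒≤ 0<δ))) ev)
  where
  open +-*-Solver

≡⇒≈ : ∀ x y → (∀ n → seq x n ≡ seq y n) → x ≈ y
≡⇒≈ x y eq = mk≈ λ ε 0<ε → 0 , λ n _ →
  subst (λ p → ℚ.∣ p ℚ.- seq y n ∣ ℚ.≤ ε) (sym (eq n)) (Seq.∣const∣ (seq y n) 0<ε)

≈-sym : ∀ {x y} → x ≈ y → y ≈ x
≈-sym {x} {y} (mk≈ xy) = mk≈ λ ε 0<ε → Seq.map₁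
  (λ n → subst (ℚ._≤ ε) (Seq.∣p-q∣≡∣q-p∣ (seq x n) (seq y n))) (xy ε 0<ε)

≈-trans : ∀ {x y z} → x ≈ y → y ≈ z → x ≈ z
≈-trans {x} {y} {z} (mk≈ xy) (mk≈ yz) = mk≈ λ ε 0<ε → Seq.map₁
  (λ n (p , q) → ℚ.≤-trans (Seq.triangle (seq x n) (seq y n) (seq z n))
    (subst (ℚ.∣ seq x n ℚ.- seq y n ∣ ℚ.+ ℚ.∣ seq y n ℚ.- seq z n ∣ ℚ.≤_) (Seq.half+half ε)
      (ℚ.+-mono-≤ {ℚ.∣ seq x n ℚ.- seq y n ∣} {½ ℚ.* ε} {ℚ.∣ seq y n ℚ.- seq z n ∣} {½ ℚ.* ε} p q)))
  (xy (½ ℚ.* ε) (Seq.half-pos 0<ε) Seq.⊗ yz (½ ℚ.* ε) (Seq.half-pos 0<ε))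

+-cong : ∀ {x y u v} → x ≈ y → u ≈ v → x + u ≈ y + v
+-cong {x} {y} {u} {v} (mk≈ xy) (mk≈ uv) = mk≈ λ ε 0<ε → Seq.map₁
  (λ n (p , q) → Seq.+-close {ε} {seq x n} {seq u n} {seq y n} {seq v n} p q)
  (xy (½ ℚ.* ε) (Seq.half-pos 0<ε) Seq.⊗ uv (½ ℚ.* ε) (Seq.half-pos 0<ε))

neg-cong : ∀ {x y} → x ≈ y → - x ≈ - y
neg-cong {x} {y} (mk≈ xy) = mk≈ λ ε 0<ε → Seq.map₁
  (λ n → Seq.neg-close {ε} {seq x n} {seq y n}) (xy ε 0<ε)

*-cong : ∀ {x y u v} → x ≈ y → u ≈ v → x * u ≈ y * v
*-cong {x} {y} {u} {v} (mk≈ xy) (mk≈ uv) = mk≈ λ ε 0<ε →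
  go ε 0<ε (Seq.bounded₂ (seq u) (seq y) (cauchy u) (cauchy y))
  where
  go : ∀ ε → 0ℚ ℚ.< ε →
       (∃ λ B → 0ℚ ℚ.< B × Seq.Eventually λ n → ℚ.∣ seq u n ∣ ℚ.≤ B × ℚ.∣ seq y n ∣ ℚ.≤ B) →
       Seq.Eventually λ n → ℚ.∣ seq x n ℚ.* seq u n ℚ.- seq y n ℚ.* seq v n ∣ ℚ.≤ ε
  go ε 0<ε (B , 0<B , bnd) = Seq.map₁
    (λ n ((p , q) , (u≤B , y≤B)) →
      Seq.*-close {ε} {B} {seq x n} {seq u n} {seq y n} {seq v n} 0<ε 0<B u≤B y≤B p q)
    (xy δ 0<δ Seq.⊗ uv δ 0<δ Seq.⊗ bnd)
    where
    δ = ½ ℚ.* ε ℚ.* Seq.inv B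
    0<δ : 0ℚ ℚ.< δ
    0<δ = Seq.*-pos {½ ℚ.* ε} {Seq.inv B} (Seq.half-pos 0<ε) (Seq.inv-pos 0<B)

≈-refl : ∀ {x} → x ≈ x
≈-refl {x} = ≡⇒≈ x x λ _ → refl

+-assoc : ∀ x y z → (x + y) + z ≈ x + (y + z)
+-assoc x y z = ≡⇒≈ ((x + y) + z) (x + (y + z)) λ n → ℚ.+-assoc (seq x n) (seq y n) (seq z n)

+-comm : ∀ x y → x + y ≈ y + x
+-comm x y = ≡⇒≈ (x + y) (y + x) λ n → ℚ.+-comm (seq x n) (seq y n)

+-identityˡ : ∀ x → 0ℝ + x ≈ x
+-identityˡ x = ≡⇒≈ (0ℝ + x) x λ n → ℚ.+-identityˡ (seq x n)

+-identityʳ : ∀ x → x + 0ℝ ≈ x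
+-identityʳ x = ≡⇒≈ (x + 0ℝ) x λ n → ℚ.+-identityʳ (seq x n)

+-inverseˡ : ∀ x → - x + x ≈ 0ℝ
+-inverseˡ x = ≡⇒≈ (- x + x) 0ℝ λ n → ℚ.+-inverseˡ (seq x n)

+-inverseʳ : ∀ x → x + - x ≈ 0ℝ
+-inverseʳ x = ≡⇒≈ (x + - x) 0ℝ λ n → ℚ.+-inverseʳ (seq x n)

*-assoc : ∀ x y z → (x * y) * z ≈ x * (y * z)
*-assoc x y z = ≡⇒≈ ((x * y) * z) (x * (y * z)) λ n → ℚ.*-assoc (seq x n) (seq y n) (seq z n)

*-comm : ∀ x y → x * y ≈ y * x
*-comm x y = ≡⇒≈ (x * y) (y * x) λ n → ℚ.*-comm (seq x n) (seq y n)

*-identityˡ : ∀ x → 1ℝ * x ≈ x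
*-identityˡ x = ≡⇒≈ (1ℝ * x) x λ n → ℚ.*-identityˡ (seq x n)

*-identityʳ : ∀ x → x * 1ℝ ≈ x
*-identityʳ x = ≡⇒≈ (x * 1ℝ) x λ n → ℚ.*-identityʳ (seq x n)

*-distribˡ-+ : ∀ x y z → x * (y + z) ≈ x * y + x * z
*-distribˡ-+ x y z = ≡⇒≈ (x * (y + z)) (x * y + x * z)
  λ n → ℚ.*-distribˡ-+ (seq x n) (seq y n) (seq z n)

*-distribʳ-+ : ∀ x y z → (y + z) * x ≈ y * x + z * x
*-distribʳ-+ x y z = ≡⇒≈ ((y + z) * x) (y * x + z * x)
  λ n → ℚ.*-distribʳ-+ (seq x n) (seq y n) (seq z n)

ℝ-commutativeRing : CommutativeRing 0ℓ 0ℓ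
ℝ-commutativeRing = record
  { Carrier = ℝ
  ; _≈_ = _≈_
  ; _+_ = _+_
  ; _*_ = _*_
  ; -_  = -_
  ; 0#  = 0ℝ
  ; 1#  = 1ℝ
  ; isCommutativeRing = record
    { isRing = record
      { +-isAbelianGroup = record
        { isGroup = record
          { isMonoid = record
            { isSemigroup = record
              { isMagma = record
                { isEquivalence = record { refl = ≈-refl ; sym = ≈-sym ; trans = ≈-trans }
                ; ∙-cong = +-cong
                }
              ; assoc = +-assoc
              }
            ; identity = +-identityˡ , +-identityʳ
            }
          ; inverse = +-inverseˡ , +-inverseʳ
          ; ⁻¹-cong = neg-cong
          }
        ; comm = +-comm
        }
      ; *-cong = *-cong
      ; *-assoc = *-assoc
      ; *-identity = *-identityˡ , *-identityʳ
      ; distrib = *-distribˡ-+ , *-distribʳ-+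
      }
    ; *-comm = *-comm
    }
  }

open RawSemiringDefinitions
  (CommutativeSemiring.rawSemiring (CommutativeRing.commutativeSemiring ℝ-commutativeRing))
  public using (_^_; product)

open import Data.Fin.Subset using (Subset; inside; outside; _∈_; ∣_∣)

bit : Bool → ℝ
bit b = if b then 1ℝ else 0ℝ

∏[_] : ∀ {n} → Subset n → (Fin n → ℝ) → ℝ
∏[ S ] g = product λ v → if lookup S v then g v else 1ℝ

-- Sum over {0,1}ⁿ; since Subset n is Vec Bool n, also the sum over all S ⊆ [n].

∑ : ∀ {n} → (Vec Bool n → ℝ) → ℝ
∑ {zero}  g = g []
∑ {suc n} g = ∑ (λ x → g (false ∷ x)) + ∑ (λ x → g (true ∷ x))

restrict : ∀ {A : Set} {n} (p : Subset n) → Vec A n → Vec A ∣ p ∣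
restrict []            []      = []
restrict (inside  ∷ p) (b ∷ x) = b ∷ restrict p x
restrict (outside ∷ p) (b ∷ x) = restrict p x

-- A Bayesian network over binary variables X₀, …, Xₙ₋₁: a directed acyclic graph
-- together with conditional probability tables μ v y = P(X_v = 1 ∣ X_{pa v} = y), all of
-- whose entries lie strictly between 0 and 1. An assignment y to pa v lists the values
-- of the parents of v in increasing order of their index.

record BayesianNetwork (n : ℕ) : Set where
  field
    pa      : Fin n → Subset n
    acyclic : ∀ v → ¬ TransClosure (λ u w → u ∈ pa w) v v
    μ       : (v : Fin n) → Vec Bool ∣ pa v ∣ → ℝ
    0<μ     : ∀ v y → 0ℝ < μ v y
    μ<1     : ∀ v y → μ v y < 1ℝ

  Edge : Fin n → Fin n → Set
  Edge u w = u ∈ pa w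

  -- Every vertex is reached from the root along edges directed from parent to child; by
  -- acyclicity the root has no parent.

  IsTree : Set
  IsTree = (∀ v → ∣ pa v ∣ ℕ.≤ 1) × ∃ λ root → ∀ v → Star Edge root v

  σ : (v : Fin n) → Vec Bool ∣ pa v ∣ → ℝ
  σ v y = sqrt (μ v y * (1ℝ - μ v y))

  0<σ : ∀ v y → 0ℝ < σ v y
  0<σ v y = 0<sqrt _ (0<* _ _ (0<μ v y) (x<y⇒0<y-x _ _ (μ<1 v y)))

  DifferenceBounded : ℝ → Set
  DifferenceBounded α = ∀ v x y → abs (μ v x - μ v y) ≤ α × abs (σ v x - σ v y) ≤ α

  probability : Vec Bool n → ℝ
  probability x = product λ v →
    let p = μ v (restrict (pa v) x) in if lookup x v then p else 1ℝ - p

  𝔼 : (Vec Bool n → ℝ) → ℝ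
  𝔼 g = ∑ λ x → probability x * g x

  φ : Fin n → Vec Bool n → ℝ
  φ v x = (bit (lookup x v) - μ v y) / σ v y [ 0<σ v y ]
    where y = restrict (pa v) x

  basis : Subset n → Vec Bool n → ℝ
  basis S x = ∏[ S ] λ v → φ v x

  coefficient : (Vec Bool n → ℝ) → Subset n → ℝ
  coefficient f S = 𝔼 λ x → f x * basis S x

  L₁ : (Vec Bool n → ℝ) → ℝ
  L₁ f = ∑ λ S → abs (coefficient f S)

conjunction : ∀ {n} → Subset n → Subset n → Vec Bool n → ℝ
conjunction T₁ T₀ x = ∏[ T₁ ] (λ i → bit (lookup x i)) * ∏[ T₀ ] (λ j → 1ℝ - bit (lookup x j))

{-# OPTIONS --safe #-}

-- A literal at v is m(y) ± s(y) φ_v, where y is the value of the parent p of v and m, s are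
-- its conditional mean and deviation (or complements). A function h of y ∈ {0,1} is
-- h(¬a) + (h(a) - h(¬a)) ℓ_p for either literal ℓ_p at p. Hence, eliminating a sink v of a
-- conjunction with d + 1 literals, its ℓ₁ norm is at most 2 times that of a conjunction with d
-- literals plus 2α times that of one with at most d + 1 literals, neither of which involves v.
-- Any K ≥ 1 with 2 + 2αK ≤ K then yields K^d, and ((2 - 2α)/(1 - 2α))² is such a K.
-- Orthonormality of the φ_S makes L₁ the ℓ₁ norm of the coefficients of any expansion.

module Submission where

open import Defs
open import Data.Fin.Subset using (Subset; Empty; ∣_∣; _∩_; _∪_)
open import Data.Nat.Base as ℕ using (ℕ)
open import Relation.Binary.PropositionalEquality using (_≡_)

open import Algebra.Bundles using (CommutativeRing; RawRing)
import Algebra.Properties.CommutativeMonoid.Sum as Sum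
import Algebra.Properties.Semiring.Exp as Exp
import Algebra.Solver.Ring as RingSolver
open import Algebra.Solver.Ring.AlmostCommutativeRing
  using (AlmostCommutativeRing; _-Raw-AlmostCommutative⟶_; fromCommutativeRing)
open import Data.Bool.Base using (Bool; true; false; not; if_then_else_; _∨_)
open import Data.Fin.Base using (Fin; zero; suc; punchIn)
open import Data.Fin.Induction using (spo-wellFounded)
open import Data.Fin.Properties using (any?; punchInᵢ≢i; _≟_)
open import Data.Fin.Subset using (inside; outside; _∈_; _∉_; _⊆_; _⊃_; ⊥; ⊤)
open import Data.Fin.Subset.Induction using (⊃-wellFounded)
open import Data.Fin.Subset.Properties using (_∈?_; ⊆-antisym; ⊆⊤; ⊥⊆; ∉⊥; ∈⊤; x∈p∩q⁺)
import Data.Maybe.Base as Maybe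
open import Data.Nat.Base using (zero; suc)
open import Data.Product.Base using (∃; _×_; _,_; proj₁; proj₂)
open import Data.Rational.Base as ℚ using (ℚ; 0ℚ; 1ℚ; ½)
import Data.Rational.Properties as ℚ
open import Data.Rational.Solver using (module +-*-Solver)
open import Data.Sum.Base using (_⊎_; inj₁; inj₂)
open import Data.Vec.Base using (Vec; []; _∷_; lookup; updateAt; _[_]≔_; here; there)
open import Data.Vec.Properties
  using (lookup∘updateAt; lookup∘updateAt′; lookup⇒[]=; []=⇒lookup; lookup-replicate; lookup-zipWith;
         updateAt-minimal; []≔-idempotent; []≔-lookup)
open import Function.Base using (_∘_)
open import Induction.WellFounded using (WellFounded; Acc; acc)
open import Level using (0ℓ)
open import Relation.Binary.Bundles using (Preorder)
open import Relation.Binary.Construct.Closure.Transitive using (TransClosure; [_]; _++_)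
open import Relation.Binary.PropositionalEquality
  using (_≢_; refl; sym; trans; cong; cong₂; subst; resp₂; isEquivalence)
import Relation.Binary.Reasoning.Preorder
import Relation.Binary.Reasoning.Setoid
open import Relation.Nullary using (¬_; ¬?; yes; no; contradiction)
open import Relation.Nullary.Decidable using (decidable-stable; _×-dec_)
open import Relation.Nullary.Decidable.Core using (dec⇒maybe)

open ℝ using (seq)

-- Ring and order properties of the reals

-- Coefficients are taken in `ℚ`, where equality is decidable, so that constants such as ½ are
-- normalised along with the ring identities.
module ℝ-Solver where

  ℚ-rawRing : RawRing 0ℓ 0ℓ
  ℚ-rawRing = record
    { _≈_ = _≡_ ; _+_ = ℚ._+_ ; _*_ = ℚ._*_ ; -_ = ℚ.-_ ; 0# = 0ℚ ; 1# = 1ℚ }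

  ℝ-ring : AlmostCommutativeRing 0ℓ 0ℓ
  ℝ-ring = fromCommutativeRing ℝ-commutativeRing

  fromℚ-homomorphism : ℚ-rawRing -Raw-AlmostCommutative⟶ ℝ-ring
  fromℚ-homomorphism = record
    { ⟦_⟧    = fromℚ
    ; +-homo = λ p q → ≡⇒≈ (fromℚ (p ℚ.+ q)) (fromℚ p + fromℚ q) λ _ → refl
    ; *-homo = λ p q → ≡⇒≈ (fromℚ (p ℚ.* q)) (fromℚ p * fromℚ q) λ _ → refl
    ; -‿homo = λ p → ≡⇒≈ (fromℚ (ℚ.- p)) (- fromℚ p) λ _ → refl
    ; 0-homo = ≈-refl
    ; 1-homo = ≈-refl
    }

  fromℚ-cong : ∀ {p q} → p ≡ q → fromℚ p ≈ fromℚ q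
  fromℚ-cong refl = ≈-refl

  open RingSolver ℚ-rawRing ℝ-ring fromℚ-homomorphism
    (λ p q → Maybe.map fromℚ-cong (dec⇒maybe (p ℚ.≟ q))) public

open ℝ-Solver using (solve; con; _:+_; _:*_; _:-_; :-_; _:=_)

≈⇒≤ : ∀ {x y} → x ≈ y → x ≤ y
≈⇒≤ {x} {y} (mk≈ xy) = mk≤ λ ε 0<ε → Seq.map₁
  (λ n le → Seq.≤-diff (ε ℚ.- (seq x n ℚ.- seq y n))
    (+-*-Solver.solve 3 (λ x y e → e S.:- (x S.:- y) S.:= (y S.:+ e) S.:- x) refl (seq x n) (seq y n) ε)
    (Seq.diff-≤ (ℚ.≤-trans (Seq.p≤∣p∣ (seq x n ℚ.- seq y n)) le)))
  (xy ε 0<ε)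
  where module S = +-*-Solver

≤-refl : ∀ {x} → x ≤ x
≤-refl = ≈⇒≤ ≈-refl

≤-trans : ∀ {x y z} → x ≤ y → y ≤ z → x ≤ z
≤-trans {x} {y} {z} (mk≤ xy) (mk≤ yz) = mk≤ λ ε 0<ε → Seq.map₁
  (λ n (p , q) → begin
    seq x n                                ≤⟨ p ⟩
    seq y n ℚ.+ ½ ℚ.* ε                    ≤⟨ ℚ.+-monoˡ-≤ (½ ℚ.* ε) q ⟩
    (seq z n ℚ.+ ½ ℚ.* ε) ℚ.+ ½ ℚ.* ε      ≡⟨ ℚ.+-assoc (seq z n) (½ ℚ.* ε) (½ ℚ.* ε) ⟩
    seq z n ℚ.+ (½ ℚ.* ε ℚ.+ ½ ℚ.* ε)      ≡⟨ cong (seq z n ℚ.+_) (Seq.half+half ε) ⟩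
    seq z n ℚ.+ ε                          ∎)
  (xy (½ ℚ.* ε) (Seq.half-pos 0<ε) Seq.⊗ yz (½ ℚ.* ε) (Seq.half-pos 0<ε))
  where open ℚ.≤-Reasoning

≤-preorder : Preorder 0ℓ 0ℓ 0ℓ
≤-preorder = record
  { Carrier    = ℝ
  ; _≈_        = _≈_
  ; _≲_        = _≤_
  ; isPreorder = record
    { isEquivalence = CommutativeRing.isEquivalence ℝ-commutativeRing
    ; reflexive     = ≈⇒≤
    ; trans         = ≤-trans
    }
  }

module ≤-Reasoning = Relation.Binary.Reasoning.Preorder ≤-preorder
module ≈-Reasoning = Relation.Binary.Reasoning.Setoid (CommutativeRing.setoid ℝ-commutativeRing)

+-mono-≤ : ∀ {x y u v} → x ≤ y → u ≤ v → x + u ≤ y + v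
+-mono-≤ {x} {y} {u} {v} (mk≤ xy) (mk≤ uv) = mk≤ λ ε 0<ε → Seq.map₁
  (λ n (p , q) → begin
    seq x n ℚ.+ seq u n                                    ≤⟨ ℚ.+-mono-≤ p q ⟩
    (seq y n ℚ.+ ½ ℚ.* ε) ℚ.+ (seq v n ℚ.+ ½ ℚ.* ε)
      ≡⟨ S.solve 3 (λ y v e → (y S.:+ e) S.:+ (v S.:+ e) S.:= (y S.:+ v) S.:+ (e S.:+ e)) refl (seq y n) (seq v n) (½ ℚ.* ε) ⟩
    (seq y n ℚ.+ seq v n) ℚ.+ (½ ℚ.* ε ℚ.+ ½ ℚ.* ε)
      ≡⟨ cong ((seq y n ℚ.+ seq v n) ℚ.+_) (Seq.half+half ε) ⟩
    (seq y n ℚ.+ seq v n) ℚ.+ ε                            ∎)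
  (xy (½ ℚ.* ε) (Seq.half-pos 0<ε) Seq.⊗ uv (½ ℚ.* ε) (Seq.half-pos 0<ε))
  where
  open ℚ.≤-Reasoning
  module S = +-*-Solver

pointwise-≤ : ∀ x y → (∀ n → seq x n ℚ.≤ seq y n) → x ≤ y
pointwise-≤ x y le = mk≤ λ ε 0<ε → 0 , λ n _ → ℚ.≤-trans (le n)
  (ℚ.≤-trans (ℚ.≤-reflexive (sym (ℚ.+-identityʳ (seq y n)))) (ℚ.+-monoʳ-≤ (seq y n) (ℚ.<⇒≤ 0<ε)))

<⇒≤ : ∀ {x y} → x < y → x ≤ y
<⇒≤ {x} {y} (mk< δ 0<δ ev) = mk≤ λ ε 0<ε → Seq.map₁
  (λ n le → begin
    seq x n          ≡⟨ ℚ.+-identityʳ (seq x n) ⟨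
    seq x n ℚ.+ 0ℚ   ≤⟨ ℚ.+-monoʳ-≤ (seq x n) (ℚ.<⇒≤ 0<δ) ⟩
    seq x n ℚ.+ δ    ≤⟨ le ⟩
    seq y n          ≡⟨ ℚ.+-identityʳ (seq y n) ⟨
    seq y n ℚ.+ 0ℚ   ≤⟨ ℚ.+-monoʳ-≤ (seq y n) (ℚ.<⇒≤ 0<ε) ⟩
    seq y n ℚ.+ ε    ∎) ev
  where open ℚ.≤-Reasoning

abs-cong : ∀ {x y} → x ≈ y → abs x ≈ abs y
abs-cong {x} {y} (mk≈ xy) = mk≈ λ ε 0<ε →
  Seq.map₁ (λ n → Seq.abs-close {ε} {seq x n} {seq y n}) (xy ε 0<ε)

abs-* : ∀ x y → abs (x * y) ≈ abs x * abs y
abs-* x y = ≡⇒≈ (abs (x * y)) (abs x * abs y) λ n → ℚ.∣p*q∣≡∣p∣*∣q∣ (seq x n) (seq y n)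

abs-neg : ∀ x → abs (- x) ≈ abs x
abs-neg x = ≡⇒≈ (abs (- x)) (abs x) λ n → ℚ.∣-p∣≡∣p∣ (seq x n)

abs-+-≤ : ∀ x y → abs (x + y) ≤ abs x + abs y
abs-+-≤ x y = pointwise-≤ (abs (x + y)) (abs x + abs y) λ n → ℚ.∣p+q∣≤∣p∣+∣q∣ (seq x n) (seq y n)

0≤abs : ∀ x → 0ℝ ≤ abs x
0≤abs x = pointwise-≤ 0ℝ (abs x) λ n → ℚ.0≤∣p∣ (seq x n)

abs-1 : abs 1ℝ ≈ 1ℝ
abs-1 = ≡⇒≈ (abs 1ℝ) 1ℝ λ _ → refl

-- The terms of `x` may be negative, but eventually only down to -ε/2; at such a term q the defect
-- ∣q∣ - q = -2q is at most ε.
0≤⇒abs≈ : ∀ {x} → 0ℝ ≤ x → abs x ≈ x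
0≤⇒abs≈ {x} (mk≤ 0≤x) = mk≈ λ ε 0<ε → Seq.map₁ (λ n → close ε 0<ε (seq x n))
  (0≤x (½ ℚ.* ε) (Seq.half-pos 0<ε))
  where
  close : ∀ ε → 0ℚ ℚ.< ε → ∀ q → 0ℚ ℚ.≤ q ℚ.+ ½ ℚ.* ε → ℚ.∣ ℚ.∣ q ∣ ℚ.- q ∣ ℚ.≤ ε
  close ε 0<ε q le = Seq.∣p∣≤
    (go (ℚ.∣p∣≡p∨∣p∣≡-p q))
    (ℚ.≤-trans (Seq.≤-diff (ℚ.∣ q ∣ ℚ.- q)
       (S.solve 2 (λ a q → a S.:- q S.:= S.con 0ℚ S.:- (S.:- (a S.:- q))) refl ℚ.∣ q ∣ q)
       (Seq.diff-≤ (Seq.p≤∣p∣ q))) (ℚ.<⇒≤ 0<ε))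
    where
    module S = +-*-Solver
    go : ℚ.∣ q ∣ ≡ q ⊎ ℚ.∣ q ∣ ≡ ℚ.- q → ℚ.∣ q ∣ ℚ.- q ℚ.≤ ε
    go (inj₁ eq) = subst (λ a → a ℚ.- q ℚ.≤ ε) (sym eq)
      (ℚ.≤-trans (ℚ.≤-reflexive (ℚ.+-inverseʳ q)) (ℚ.<⇒≤ 0<ε))
    go (inj₂ eq) = subst (λ a → a ℚ.- q ℚ.≤ ε) (sym eq)
      (Seq.≤-diff ((q ℚ.+ ½ ℚ.* ε) ℚ.+ (q ℚ.+ ½ ℚ.* ε))
        (S.solve 2 (λ q e → (q S.:+ S.con ½ S.:* e) S.:+ (q S.:+ S.con ½ S.:* e)
                              S.:= e S.:- ((S.:- q) S.:- q)) refl q ε)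
        (Seq.+-nonNeg le le))

0≤-resp-≈ : ∀ {x y} → x ≈ y → 0ℝ ≤ x → 0ℝ ≤ y
0≤-resp-≈ x≈y 0≤x = ≤-trans 0≤x (≈⇒≤ x≈y)

-- A non-negative real equals its absolute value, so no estimate is needed here.

*-nonNeg : ∀ {x y} → 0ℝ ≤ x → 0ℝ ≤ y → 0ℝ ≤ x * y
*-nonNeg {x} {y} 0≤x 0≤y = 0≤-resp-≈
  (≈-trans (abs-* x y) (*-cong (0≤⇒abs≈ 0≤x) (0≤⇒abs≈ 0≤y))) (0≤abs (x * y))

+-nonNeg : ∀ {x y} → 0ℝ ≤ x → 0ℝ ≤ y → 0ℝ ≤ x + y
+-nonNeg 0≤x 0≤y = 0≤-resp-≈ ≈-refl
  (≤-trans (≈⇒≤ (≈-sym (+-identityˡ 0ℝ))) (+-mono-≤ 0≤x 0≤y))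

x≤y⇒0≤y-x : ∀ {x y} → x ≤ y → 0ℝ ≤ y - x
x≤y⇒0≤y-x {x} {y} x≤y =
  ≤-trans (≈⇒≤ (≈-sym (+-inverseʳ x))) (+-mono-≤ x≤y (≤-refl { - x}))

0≤y-x⇒x≤y : ∀ {x y} → 0ℝ ≤ y - x → x ≤ y
0≤y-x⇒x≤y {x} {y} 0≤y-x = begin
  x            ≈⟨ +-identityˡ x ⟨
  0ℝ + x       ≲⟨ +-mono-≤ 0≤y-x ≤-refl ⟩
  (y - x) + x  ≈⟨ solve 2 (λ x y → (y :- x) :+ x := y) ≈-refl x y ⟩
  y            ∎
  where open ≤-Reasoning

-- Reduces an inequality to a ring identity that exhibits the difference as a visibly non-negative
-- expression.
≤-diff : ∀ {x y} d → d ≈ y - x → 0ℝ ≤ d → x ≤ y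
≤-diff d eq 0≤d = 0≤y-x⇒x≤y (0≤-resp-≈ eq 0≤d)

*-monoˡ-≤ : ∀ {x y z} → 0ℝ ≤ x → y ≤ z → x * y ≤ x * z
*-monoˡ-≤ {x} {y} {z} 0≤x y≤z = ≤-diff (x * (z - y))
  (solve 3 (λ x y z → x :* (z :- y) := x :* z :- x :* y) ≈-refl x y z)
  (*-nonNeg 0≤x (x≤y⇒0≤y-x y≤z))

*-monoʳ-≤ : ∀ {x y z} → 0ℝ ≤ x → y ≤ z → y * x ≤ z * x
*-monoʳ-≤ {x} {y} {z} 0≤x y≤z = ≤-diff ((z - y) * x)
  (solve 3 (λ x y z → (z :- y) :* x := z :* x :- y :* x) ≈-refl x y z)
  (*-nonNeg (x≤y⇒0≤y-x y≤z) 0≤x)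

0≤1 : 0ℝ ≤ 1ℝ
0≤1 = pointwise-≤ 0ℝ 1ℝ λ _ → ℚ.<⇒≤ Seq.0<1

0≤½ : 0ℝ ≤ ½ℝ
0≤½ = pointwise-≤ 0ℝ ½ℝ λ _ → ℚ.<⇒≤ Seq.0<½

0≤x² : ∀ x → 0ℝ ≤ x * x
0≤x² x = ≤-trans (*-nonNeg (0≤abs x) (0≤abs x)) (≈⇒≤ (≈-trans (≈-sym (abs-* x x))
  (≡⇒≈ (abs (x * x)) (x * x) λ n → square (seq x n))))
  where
  square : ∀ q → ℚ.∣ q ℚ.* q ∣ ≡ q ℚ.* q
  square q with ℚ.∣p∣≡p∨∣p∣≡-p q
  ... | inj₁ eq = trans (ℚ.∣p*q∣≡∣p∣*∣q∣ q q) (cong₂ ℚ._*_ eq eq)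
  ... | inj₂ eq = trans (ℚ.∣p*q∣≡∣p∣*∣q∣ q q) (trans (cong₂ ℚ._*_ eq eq)
    (S.solve 1 (λ q → (S.:- q) S.:* (S.:- q) S.:= q S.:* q) refl q))
    where module S = +-*-Solver

-- The reciprocal r of x equals x r², a product of non-negative factors.
0≤recip : ∀ x (0<x : 0ℝ < x) → 0ℝ ≤ recip x 0<x
0≤recip x 0<x = ≤-trans (*-nonNeg (<⇒≤ 0<x) (0≤x² r)) (≈⇒≤ (begin
  x * (r * r)  ≈⟨ *-assoc x r r ⟨
  (x * r) * r  ≈⟨ *-cong (*-recip x 0<x) ≈-refl ⟩
  1ℝ * r       ≈⟨ *-identityˡ r ⟩
  r            ∎))
  where
  open ≈-Reasoning
  r = recip x 0<x

-- Uniqueness of inverses, which also makes the choice of positivity proof irrelevant.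
recip-cong : ∀ {x y} {0<x : 0ℝ < x} {0<y : 0ℝ < y} → x ≈ y → recip x 0<x ≈ recip y 0<y
recip-cong {x} {y} {0<x} {0<y} x≈y = begin
  r              ≈⟨ *-identityʳ r ⟨
  r * 1ℝ         ≈⟨ *-cong ≈-refl (*-recip y 0<y) ⟨
  r * (y * s)    ≈⟨ *-cong ≈-refl (*-cong x≈y ≈-refl) ⟨
  r * (x * s)    ≈⟨ solve 3 (λ r x s → r :* (x :* s) := (x :* r) :* s) ≈-refl r x s ⟩
  (x * r) * s    ≈⟨ *-cong (*-recip x 0<x) ≈-refl ⟩
  1ℝ * s         ≈⟨ *-identityˡ s ⟩
  s              ∎
  where
  open ≈-Reasoning
  r = recip x 0<x
  s = recip y 0<y

abs≤1 : ∀ {x} → 0ℝ ≤ x → x ≤ 1ℝ → abs x ≤ 1ℝ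
abs≤1 0≤x x≤1 = ≤-trans (≈⇒≤ (0≤⇒abs≈ 0≤x)) x≤1

-- 1 - x is the mean of (1 - x)² and 1 - x².

x²≤1⇒x≤1 : ∀ {x} → x * x ≤ 1ℝ → x ≤ 1ℝ
x²≤1⇒x≤1 {x} x²≤1 = ≤-diff (½ℝ * ((1ℝ - x) * (1ℝ - x) + (1ℝ - x * x)))
  (solve 1 (λ x → con ½ :* ((con 1ℚ :- x) :* (con 1ℚ :- x) :+ (con 1ℚ :- x :* x)) := con 1ℚ :- x) ≈-refl x)
  (*-nonNeg 0≤½ (+-nonNeg (0≤x² (1ℝ - x)) (x≤y⇒0≤y-x x²≤1)))

module ∏ = Sum (CommutativeRing.*-commutativeMonoid ℝ-commutativeRing)

-- Finite sums and products

≈-reflexive : ∀ {x y : ℝ} → x ≡ y → x ≈ y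
≈-reflexive refl = ≈-refl

∑-cong : ∀ {n} {f g : Vec Bool n → ℝ} → (∀ x → f x ≈ g x) → ∑ f ≈ ∑ g
∑-cong {zero}  f≈g = f≈g []
∑-cong {suc n} f≈g = +-cong (∑-cong λ x → f≈g (false ∷ x)) (∑-cong λ x → f≈g (true ∷ x))

∑-mono : ∀ {n} {f g : Vec Bool n → ℝ} → (∀ x → f x ≤ g x) → ∑ f ≤ ∑ g
∑-mono {zero}  f≤g = f≤g []
∑-mono {suc n} f≤g = +-mono-≤ (∑-mono λ x → f≤g (false ∷ x)) (∑-mono λ x → f≤g (true ∷ x))

∑-distrib-+ : ∀ {n} (f g : Vec Bool n → ℝ) → ∑ (λ x → f x + g x) ≈ ∑ f + ∑ g
∑-distrib-+ {zero}  f g = ≈-refl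
∑-distrib-+ {suc n} f g = ≈-trans
  (+-cong (∑-distrib-+ (f ∘ (false ∷_)) (g ∘ (false ∷_))) (∑-distrib-+ (f ∘ (true ∷_)) (g ∘ (true ∷_))))
  (solve 4 (λ a b c d → (a :+ b) :+ (c :+ d) := (a :+ c) :+ (b :+ d)) ≈-refl
    (∑ (f ∘ (false ∷_))) (∑ (g ∘ (false ∷_))) (∑ (f ∘ (true ∷_))) (∑ (g ∘ (true ∷_))))

∑-distribˡ-* : ∀ {n} c (f : Vec Bool n → ℝ) → ∑ (λ x → c * f x) ≈ c * ∑ f
∑-distribˡ-* {zero}  c f = ≈-refl
∑-distribˡ-* {suc n} c f = ≈-trans
  (+-cong (∑-distribˡ-* c (f ∘ (false ∷_))) (∑-distribˡ-* c (f ∘ (true ∷_))))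
  (≈-sym (*-distribˡ-+ c _ _))

flip : ∀ {n} → Fin n → Vec Bool n → Vec Bool n
flip v x = updateAt x v not

∑-flip : ∀ {n} v (f : Vec Bool n → ℝ) → ∑ (f ∘ flip v) ≈ ∑ f
∑-flip zero    f = +-comm _ _
∑-flip (suc v) f = +-cong (∑-flip v (f ∘ (false ∷_))) (∑-flip v (f ∘ (true ∷_)))

-- Sums out the variable v. Pairing x with `flip v x` counts every pair twice, hence the factor ½.
∑-flip-average : ∀ {n} v (k g : Vec Bool n → ℝ) c → (∀ x → g (flip v x) ≈ g x) →
                 (∀ x → k x + k (flip v x) ≈ c) → ∑ (λ x → k x * g x) ≈ ½ℝ * c * ∑ g
∑-flip-average v k g c g-flip k-flip = begin
  s                           ≈⟨ solve 1 (λ s → s := con ½ :* (s :+ s)) ≈-refl s ⟩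
  ½ℝ * (s + s)                ≈⟨ *-cong ≈-refl (+-cong ≈-refl (∑-flip v (λ x → k x * g x))) ⟨
  ½ℝ * (s + s′)               ≈⟨ *-cong ≈-refl (∑-distrib-+ (λ x → k x * g x) (λ x → k (flip v x) * g (flip v x))) ⟨
  ½ℝ * ∑ (λ x → k x * g x + k (flip v x) * g (flip v x))
                              ≈⟨ *-cong ≈-refl (∑-cong collect) ⟩
  ½ℝ * ∑ (λ x → c * g x)      ≈⟨ *-cong ≈-refl (∑-distribˡ-* c g) ⟩
  ½ℝ * (c * ∑ g)              ≈⟨ *-assoc ½ℝ c (∑ g) ⟨
  ½ℝ * c * ∑ g                ∎
  where
  open ≈-Reasoning
  s = ∑ (λ x → k x * g x)
  s′ = ∑ (λ x → k (flip v x) * g (flip v x))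
  collect : ∀ x → k x * g x + k (flip v x) * g (flip v x) ≈ c * g x
  collect x = begin
    k x * g x + k (flip v x) * g (flip v x)  ≈⟨ +-cong ≈-refl (*-cong ≈-refl (g-flip x)) ⟩
    k x * g x + k (flip v x) * g x           ≈⟨ *-distribʳ-+ (g x) (k x) (k (flip v x)) ⟨
    (k x + k (flip v x)) * g x               ≈⟨ *-cong (k-flip x) ≈-refl ⟩
    c * g x                                  ∎

product-cong : ∀ {n} {f g : Fin n → ℝ} → (∀ w → f w ≈ g w) → product f ≈ product g
product-cong = ∏.sum-cong-≋

product-* : ∀ {n} (f g : Fin n → ℝ) → product (λ w → f w * g w) ≈ product f * product g
product-* = ∏.∑-distrib-+

-- Cross-multiplied, so that no factor has to be inverted.
product-agree : ∀ {n} v (f g : Fin n → ℝ) → (∀ w → w ≢ v → f w ≈ g w) →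
                product f * g v ≈ f v * product g
product-agree {suc n} v f g f≈g = begin
  product f * g v              ≈⟨ *-cong (∏.sum-remove f) ≈-refl ⟩
  (f v * product f′) * g v     ≈⟨ *-cong (*-cong ≈-refl (product-cong λ w → f≈g (punchIn v w) (punchInᵢ≢i v w))) ≈-refl ⟩
  (f v * product g′) * g v     ≈⟨ solve 3 (λ a b c → (a :* b) :* c := a :* (c :* b)) ≈-refl (f v) (product g′) (g v) ⟩
  f v * (g v * product g′)     ≈⟨ *-cong ≈-refl (∏.sum-remove g) ⟨
  f v * product g              ∎
  where
  open ≈-Reasoning
  f′ = f ∘ punchIn v
  g′ = g ∘ punchIn v

∉⇒outside : ∀ {n} {v} {U : Subset n} → v ∉ U → lookup U v ≡ outside
∉⇒outside {v = v} {U} v∉U with lookup U v in eq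
... | true  = contradiction (lookup⇒[]= v U eq) v∉U
... | false = refl

∏-insert : ∀ {n} {v} {U : Subset n} (g : Fin n → ℝ) → v ∉ U →
           ∏[ U [ v ]≔ inside ] g ≈ g v * ∏[ U ] g
∏-insert {v = v} {U} g v∉U = begin
  ∏[ U [ v ]≔ inside ] g              ≈⟨ *-identityʳ _ ⟨
  ∏[ U [ v ]≔ inside ] g * 1ℝ         ≡⟨ cong (λ b → ∏[ U [ v ]≔ inside ] g * (if b then g v else 1ℝ)) (∉⇒outside v∉U) ⟨
  ∏[ U [ v ]≔ inside ] g * term U v   ≈⟨ product-agree v (term (U [ v ]≔ inside)) (term U)
                                           (λ w w≢v → ≈-reflexive (cong (λ b → if b then g w else 1ℝ) (lookup∘updateAt′ w v w≢v U))) ⟩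
  term (U [ v ]≔ inside) v * ∏[ U ] g ≡⟨ cong (λ b → (if b then g v else 1ℝ) * ∏[ U ] g) (lookup∘updateAt v U) ⟩
  g v * ∏[ U ] g                      ∎
  where
  open ≈-Reasoning
  term : Subset _ → Fin _ → ℝ
  term U w = if lookup U w then g w else 1ℝ

∏-⊥ : ∀ {n} (g : Fin n → ℝ) → ∏[ ⊥ ] g ≈ 1ℝ
∏-⊥ {zero}  g = ≈-refl
∏-⊥ {suc n} g = ≈-trans (*-identityˡ (∏[ ⊥ {n} ] (g ∘ suc))) (∏-⊥ {n} (g ∘ suc))

∏-⊤ : ∀ {n} (g : Fin n → ℝ) → ∏[ ⊤ ] g ≈ product g
∏-⊤ g = product-cong λ w → ≈-reflexive (cong (λ b → if b then g w else 1ℝ) ([]=⇒lookup (∈⊤ {x = w})))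

∑-½ⁿ : ∀ n → ∑ {n} (λ _ → product {n} λ _ → ½ℝ) ≈ 1ℝ
∑-½ⁿ zero    = ≈-refl
∑-½ⁿ (suc n) = begin
  s + s                ≈⟨ +-cong half half ⟩
  ½ℝ * 1ℝ + ½ℝ * 1ℝ    ≈⟨ solve 0 (con ½ :* con 1ℚ :+ con ½ :* con 1ℚ := con 1ℚ) ≈-refl ⟩
  1ℝ                   ∎
  where
  open ≈-Reasoning
  s = ∑ {n} (λ _ → product {suc n} λ _ → ½ℝ)
  half : s ≈ ½ℝ * 1ℝ
  half = ≈-trans (∑-distribˡ-* {n} ½ℝ (λ _ → product {n} λ _ → ½ℝ)) (*-cong ≈-refl (∑-½ⁿ n))

-- The indicator of `a ≡ b`, as the positive or negative literal in `b`.
literal : Bool → Bool → ℝ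
literal a b = if a then bit b else 1ℝ - bit b

-- The Kronecker delta on the cube, in the product form that summing out the variables one by one
-- produces.
δ : ∀ {n} → Vec Bool n → Vec Bool n → ℝ
δ x y = product λ w → literal (lookup x w) (lookup y w)

∑-δ : ∀ {n} (x : Vec Bool n) → ∑ (λ y → abs (δ x y)) ≈ 1ℝ
∑-δ []      = abs-1
∑-δ (b ∷ x) = begin
  ∑ (λ y → abs (literal b false * δ x y)) + ∑ (λ y → abs (literal b true * δ x y))
                         ≈⟨ +-cong (pull (literal b false)) (pull (literal b true)) ⟩
  abs (literal b false) + abs (literal b true)
                         ≈⟨ cases b ⟩
  1ℝ                     ∎
  where
  open ≈-Reasoning
  pull : ∀ c → ∑ (λ y → abs (c * δ x y)) ≈ abs c
  pull c = begin
    ∑ (λ y → abs (c * δ x y))        ≈⟨ ∑-cong (λ y → abs-* c (δ x y)) ⟩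
    ∑ (λ y → abs c * abs (δ x y))    ≈⟨ ∑-distribˡ-* (abs c) (λ y → abs (δ x y)) ⟩
    abs c * ∑ (λ y → abs (δ x y))    ≈⟨ *-cong ≈-refl (∑-δ x) ⟩
    abs c * 1ℝ                       ≈⟨ *-identityʳ (abs c) ⟩
    abs c                            ∎
  cases : ∀ b → abs (literal b false) + abs (literal b true) ≈ 1ℝ
  cases true  = ≡⇒≈ _ _ λ _ → refl
  cases false = ≡⇒≈ _ _ λ _ → refl

-- Subsets and restrictions

∈-insert⁻ : ∀ {n} {v w} (U : Subset n) → w ∈ U [ v ]≔ inside → w ≡ v ⊎ w ∈ U
∈-insert⁻ {v = v} {w} U w∈ with w ≟ v
... | yes w≡v = inj₁ w≡v
... | no  w≢v = inj₂ (lookup⇒[]= w U (trans (sym (lookup∘updateAt′ w v w≢v U)) ([]=⇒lookup w∈)))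

∈-insert-self : ∀ {n} v (U : Subset n) → v ∈ U [ v ]≔ inside
∈-insert-self v U = lookup⇒[]= v _ (lookup∘updateAt v U)

⊆-insert : ∀ {n} v (U : Subset n) → U ⊆ U [ v ]≔ inside
⊆-insert v U {w} w∈U with w ≟ v
... | yes refl = ∈-insert-self v U
... | no  w≢v  = updateAt-minimal w v U w≢v w∈U

restrict-updateAt : ∀ {A : Set} {n} (p : Subset n) {v} (x : Vec A n) {f : A → A} → v ∉ p →
                    restrict p (updateAt x v f) ≡ restrict p x
restrict-updateAt (inside  ∷ p) {zero}  (b ∷ x) v∉p = contradiction here v∉p
restrict-updateAt (outside ∷ p) {zero}  (b ∷ x) v∉p = refl
restrict-updateAt (inside  ∷ p) {suc v} (b ∷ x) v∉p = cong (b ∷_) (restrict-updateAt p x (v∉p ∘ there))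
restrict-updateAt (outside ∷ p) {suc v} (b ∷ x) v∉p = restrict-updateAt p x (v∉p ∘ there)

-- Orthonormality of the basis

module _ {n : ℕ} (D : BayesianNetwork n) where

  open BayesianNetwork D

  -- A derivation is a topological order of U: each inserted variable has all its parents among the
  -- earlier ones, and is a sink at that moment. Inductions over derivations eliminate sinks.
  data AncestorClosed : Subset n → Set where
    empty  : AncestorClosed ⊥
    insert : ∀ {U v} → AncestorClosed U → v ∉ U → pa v ⊆ U → AncestorClosed (U [ v ]≔ inside)

  parents-⊆ : ∀ {U w} → AncestorClosed U → w ∈ U → pa w ⊆ U
  parents-⊆ empty w∈U = contradiction w∈U ∉⊥
  parents-⊆ (insert {U} {v} cl v∉U pa⊆U) w∈ u∈ with ∈-insert⁻ U w∈
  ... | inj₁ refl = ⊆-insert v U (pa⊆U u∈)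
  ... | inj₂ w∈U  = ⊆-insert v U (parents-⊆ cl w∈U u∈)

  -- By acyclicity the ancestor relation is a strict partial order, and on a finite set this is
  -- well-founded.
  ancestor-wellFounded : WellFounded (TransClosure Edge)
  ancestor-wellFounded = spo-wellFounded record
    { isEquivalence = isEquivalence
    ; irrefl        = λ { refl cycle → acyclic _ cycle }
    ; trans         = _++_
    ; <-resp-≈      = resp₂ (TransClosure Edge)
    }

  -- As long as some parent lies outside U, move to it; well-foundedness stops the walk.
  source : ∀ U v → v ∉ U → Acc (TransClosure Edge) v → ∃ λ w → w ∉ U × pa w ⊆ U
  source U v v∉U (acc rec) with any? (λ u → u ∈? pa v ×-dec ¬? (u ∈? U))
  ... | yes (u , u∈pa , u∉U) = source U u u∉U (rec [ u∈pa ])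
  ... | no ∄u = v , v∉U , λ {u} u∈pa → decidable-stable (u ∈? U) λ u∉U → ∄u (u , u∈pa , u∉U)

  ⊤-ancestorClosed : AncestorClosed ⊤
  ⊤-ancestorClosed = extend ⊥ (⊃-wellFounded ⊥) empty
    where
    extend : ∀ U → Acc _⊃_ U → AncestorClosed U → AncestorClosed ⊤
    extend U (acc rec) cl with any? (λ v → ¬? (v ∈? U))
    ... | no ∄v = subst AncestorClosed
      (⊆-antisym ⊆⊤ λ {v} _ → decidable-stable (v ∈? U) λ v∉U → ∄v (v , v∉U)) cl
    ... | yes (v , v∉U) with source U v v∉U (ancestor-wellFounded v)
    ...   | w , w∉U , pa⊆U = extend (U [ w ]≔ inside)
      (rec (⊆-insert w U , w , ∈-insert-self w U , w∉U)) (insert cl w∉U pa⊆U)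

  module _ (k : ∀ w → Bool → Vec Bool ∣ pa w ∣ → ℝ) (c : Fin n → ℝ)
           (k-sum : ∀ w y → k w true y + k w false y ≈ c w) where

    local : Fin n → Vec Bool n → ℝ
    local w x = k w (lookup x w) (restrict (pa w) x)

    -- The factor ½ cancels the sum over a variable outside U.

    partial : Subset n → Vec Bool n → ℝ
    partial U x = product λ w → if lookup U w then local w x else ½ℝ

    -- The last inserted variable v occurs in no factor of an earlier variable, since the parents of
    -- those lie in U. Summing over v therefore turns its own factor into `c v` and leaves the rest
    -- unchanged.
    ∑-partial : ∀ {U} → AncestorClosed U → ∑ (partial U) ≈ ∏[ U ] c
    ∑-partial empty = begin
      ∑ (partial ⊥)
        ≈⟨ ∑-cong (λ x → product-cong λ w → ≈-reflexive (cong (λ b → if b then local w x else ½ℝ) (lookup-replicate w outside))) ⟩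
      ∑ {n} (λ _ → product {n} λ _ → ½ℝ)  ≈⟨ ∑-½ⁿ n ⟩
      1ℝ                                  ≈⟨ ∏-⊥ c ⟨
      ∏[ ⊥ ] c ∎
      where open ≈-Reasoning
    ∑-partial (insert {U} {v} cl v∉U pa⊆U) = begin
      ∑ (partial V)                                      ≈⟨ ∑-cong split ⟩
      ∑ (λ x → local v x * (2ℝ * partial U x))           ≈⟨ ∑-flip-average v (local v) (λ x → 2ℝ * partial U x) (c v) invariant average ⟩
      ½ℝ * c v * ∑ (λ x → 2ℝ * partial U x)                ≈⟨ *-cong ≈-refl (∑-distribˡ-* 2ℝ (partial U)) ⟩
      ½ℝ * c v * (2ℝ * ∑ (partial U))
        ≈⟨ solve 2 (λ l s → con ½ :* l :* (con (1ℚ ℚ.+ 1ℚ) :* s) := l :* s) ≈-refl (c v) (∑ (partial U)) ⟩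
      c v * ∑ (partial U)                                  ≈⟨ *-cong ≈-refl (∑-partial cl) ⟩
      c v * ∏[ U ] c ≈⟨ ∏-insert c v∉U ⟨
      ∏[ V ] c   ∎
      where
      open ≈-Reasoning
      V = U [ v ]≔ inside
      term : Subset n → Vec Bool n → Fin n → ℝ
      term U x w = if lookup U w then local w x else ½ℝ

      -- The 2 cancels the ½ that `partial U` carries at v.
      split : ∀ x → partial V x ≈ local v x * (2ℝ * partial U x)
      split x = begin
        partial V x
          ≈⟨ solve 1 (λ p → p := con (1ℚ ℚ.+ 1ℚ) :* (p :* con ½)) ≈-refl (partial V x) ⟩
        2ℝ * (partial V x * ½ℝ)
          ≡⟨ cong (λ b → 2ℝ * (partial V x * (if b then local v x else ½ℝ))) (∉⇒outside v∉U) ⟨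
        2ℝ * (partial V x * term U x v)
          ≈⟨ *-cong ≈-refl (product-agree v (term V x) (term U x)
               λ w w≢v → ≈-reflexive (cong (λ b → if b then local w x else ½ℝ) (lookup∘updateAt′ w v w≢v U))) ⟩
        2ℝ * (term V x v * partial U x)
          ≡⟨ cong (λ b → 2ℝ * ((if b then local v x else ½ℝ) * partial U x)) (lookup∘updateAt v U) ⟩
        2ℝ * (local v x * partial U x)
          ≈⟨ solve 2 (λ a p → con (1ℚ ℚ.+ 1ℚ) :* (a :* p) := a :* (con (1ℚ ℚ.+ 1ℚ) :* p)) ≈-refl (local v x) (partial U x) ⟩
        local v x * (2ℝ * partial U x) ∎

      term-flip : ∀ x w → term U (flip v x) w ≡ term U x w
      term-flip x w with lookup U w in eq
      ... | false = refl
      ... | true  = cong₂ (k w)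
        (lookup∘updateAt′ w v (λ { refl → v∉U w∈U }) x)
        (restrict-updateAt (pa w) x λ v∈pa → v∉U (parents-⊆ cl w∈U v∈pa))
        where w∈U = lookup⇒[]= w U eq

      invariant : ∀ x → 2ℝ * partial U (flip v x) ≈ 2ℝ * partial U x
      invariant x = *-cong ≈-refl (product-cong λ w → ≈-reflexive (term-flip x w))

      average : ∀ x → local v x + local v (flip v x) ≈ c v
      average x = begin
        local v x + local v (flip v x)
          ≡⟨ cong (local v x +_) (cong₂ (k v)
               (lookup∘updateAt v x) (restrict-updateAt (pa v) x (v∉U ∘ pa⊆U))) ⟩
        local v x + k v (not (lookup x v)) y
          ≈⟨ both (lookup x v) ⟩
        c v ∎
        where
        y = restrict (pa v) x
        both : ∀ b → k v b y + k v (not b) y ≈ c v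
        both true  = k-sum v y
        both false = ≈-trans (+-comm _ _) (k-sum v y)

    ∑-product : ∑ (λ x → product λ w → local w x) ≈ product c
    ∑-product = begin
      ∑ (λ x → product λ w → local w x)
        ≈⟨ ∑-cong (λ x → product-cong λ w → ≈-reflexive (cong (λ b → if b then local w x else ½ℝ) ([]=⇒lookup (∈⊤ {x = w})))) ⟨
      ∑ (partial ⊤)    ≈⟨ ∑-partial ⊤-ancestorClosed ⟩
      ∏[ ⊤ ] c         ≈⟨ ∏-⊤ c ⟩
      product c        ∎
      where open ≈-Reasoning

  weight : ∀ v → Bool → Vec Bool ∣ pa v ∣ → ℝ
  weight v b y = if b then μ v y else 1ℝ - μ v y

  normalised : ∀ v → Bool → Vec Bool ∣ pa v ∣ → ℝ
  normalised v b y = (bit b - μ v y) / σ v y [ 0<σ v y ]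

  -- By recip-cong, the two proofs of 0 < σ, which are huge once unfolded, need not be compared.

  φ≈normalised : ∀ v x → φ v x ≈ normalised v (lookup x v) (restrict (pa v) x)
  φ≈normalised v x = *-cong ≈-refl (recip-cong ≈-refl)

  -- The contribution of v to the probability times φ_S φ_T, where `s` and `t` tell whether v lies
  -- in S and in T.
  factor : Bool → Bool → ∀ v → Bool → Vec Bool ∣ pa v ∣ → ℝ
  factor s t v b y =
    weight v b y * ((if s then normalised v b y else 1ℝ) * (if t then normalised v b y else 1ℝ))

  σ² : ∀ v y → σ v y * σ v y ≈ μ v y * (1ℝ - μ v y)
  σ² v y = sqrt-*-sqrt _ (<⇒≤ (0<* _ _ (0<μ v y) (x<y⇒0<y-x _ _ (μ<1 v y))))

  -- Given the parents, the four cases say that total probability is 1, that φ_v has mean 0 (twice),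
  -- and that it has variance 1; the last uses σ² = μ(1 - μ).
  factor-orthonormal : ∀ s t v y → factor s t v true y + factor s t v false y ≈ literal s t
  factor-orthonormal s t v y = go s t
    where
    open ≈-Reasoning
    p = μ v y
    r = recip (σ v y) (0<σ v y)
    go : ∀ s t → factor s t v true y + factor s t v false y ≈ literal s t
    go false false = solve 1 (λ p → p :* (con 1ℚ :* con 1ℚ) :+ (con 1ℚ :- p) :* (con 1ℚ :* con 1ℚ)
                                      := con 1ℚ :- con 0ℚ) ≈-refl p
    go true  false = solve 2 (λ p r → p :* (((con 1ℚ :- p) :* r) :* con 1ℚ)
                                        :+ (con 1ℚ :- p) :* (((con 0ℚ :- p) :* r) :* con 1ℚ)
                                      := con 0ℚ) ≈-refl p r
    go false true  = solve 2 (λ p r → p :* (con 1ℚ :* ((con 1ℚ :- p) :* r))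
                                        :+ (con 1ℚ :- p) :* (con 1ℚ :* ((con 0ℚ :- p) :* r))
                                      := con 1ℚ :- con 1ℚ) ≈-refl p r
    go true  true  = begin
      factor true true v true y + factor true true v false y
        ≈⟨ solve 2 (λ p r → p :* (((con 1ℚ :- p) :* r) :* ((con 1ℚ :- p) :* r))
                              :+ (con 1ℚ :- p) :* (((con 0ℚ :- p) :* r) :* ((con 0ℚ :- p) :* r))
                              := (p :* (con 1ℚ :- p)) :* (r :* r)) ≈-refl p r ⟩
      (p * (1ℝ - p)) * (r * r)     ≈⟨ *-cong (σ² v y) ≈-refl ⟨
      (σ v y * σ v y) * (r * r)
        ≈⟨ solve 2 (λ s r → (s :* s) :* (r :* r) := (s :* r) :* (s :* r)) ≈-refl (σ v y) r ⟩
      (σ v y * r) * (σ v y * r)    ≈⟨ *-cong (*-recip _ (0<σ v y)) (*-recip _ (0<σ v y)) ⟩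
      1ℝ * 1ℝ                      ≈⟨ *-identityˡ 1ℝ ⟩
      1ℝ                           ∎

  -- The summand is a product of local factors, so the variables can be summed out one at a time.
  basis-orthonormal : ∀ S T → coefficient (basis S) T ≈ δ S T
  basis-orthonormal S T = ≈-trans (∑-cong merge)
    (∑-product k (λ w → literal (lookup S w) (lookup T w))
      λ w → factor-orthonormal (lookup S w) (lookup T w) w)
    where
    open ≈-Reasoning
    k : ∀ w → Bool → Vec Bool ∣ pa w ∣ → ℝ
    k w = factor (lookup S w) (lookup T w) w
    term : Subset n → Vec Bool n → Fin n → ℝ
    term S x w = if lookup S w then φ w x else 1ℝ
    term≈ : ∀ s x w → (if s then φ w x else 1ℝ) ≈ (if s then normalised w (lookup x w) (restrict (pa w) x) else 1ℝ)
    term≈ true  x w = φ≈normalised w x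
    term≈ false x w = ≈-refl
    merge : ∀ x → probability x * (basis S x * basis T x) ≈ product (λ w → k w (lookup x w) (restrict (pa w) x))
    merge x = begin
      probability x * (basis S x * basis T x)
        ≈⟨ *-cong ≈-refl (product-* (term S x) (term T x)) ⟨
      probability x * product (λ w → term S x w * term T x w)
        ≈⟨ product-* p (λ w → term S x w * term T x w) ⟨
      product (λ w → p w * (term S x w * term T x w))
        ≈⟨ product-cong (λ w → *-cong ≈-refl (*-cong (term≈ (lookup S w) x w) (term≈ (lookup T w) x w))) ⟩
      product (λ w → k w (lookup x w) (restrict (pa w) x)) ∎
      where
      p : Fin n → ℝ
      p w = weight w (lookup x w) (restrict (pa w) x)

  L₁-basis : ∀ S → L₁ (basis S) ≈ 1ℝ
  L₁-basis S = ≈-trans (∑-cong λ T → abs-cong (basis-orthonormal S T)) (∑-δ S)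

-- Inserting and removing elements; restriction to at most one coordinate

∣insert∣ : ∀ {n} {v} (U : Subset n) → v ∉ U → ∣ U [ v ]≔ inside ∣ ≡ suc ∣ U ∣
∣insert∣ {v = zero}  (inside  ∷ U) v∉U = contradiction here v∉U
∣insert∣ {v = zero}  (outside ∷ U) v∉U = refl
∣insert∣ {v = suc v} (inside  ∷ U) v∉U = cong suc (∣insert∣ U (v∉U ∘ there))
∣insert∣ {v = suc v} (outside ∷ U) v∉U = ∣insert∣ U (v∉U ∘ there)

remove : ∀ {n} {v} (T : Subset n) → v ∈ T → ∃ λ T′ → v ∉ T′ × T ≡ T′ [ v ]≔ inside × T′ ⊆ T
remove {v = v} T v∈T = T′ , v∉T′ , eq , subst (T′ ⊆_) (sym eq) (⊆-insert v T′)
  where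
  T′ = T [ v ]≔ outside
  v∉T′ : v ∉ T′
  v∉T′ v∈T′ = contradiction (trans (sym (lookup∘updateAt v T)) ([]=⇒lookup v∈T′)) λ ()
  eq : T ≡ T′ [ v ]≔ inside
  eq = trans (sym ([]≔-lookup T v))
    (trans (cong (T [ v ]≔_) ([]=⇒lookup v∈T)) (sym ([]≔-idempotent T v)))

⊆-insert⁻ : ∀ {n} {v} {T : Subset n} (U : Subset n) → v ∉ T → T ⊆ U [ v ]≔ inside → T ⊆ U
⊆-insert⁻ U v∉T T⊆ w∈T with ∈-insert⁻ U (T⊆ w∈T)
... | inj₁ refl = contradiction w∈T v∉T
... | inj₂ w∈U  = w∈U

insert-⊆ : ∀ {n} v {T : Subset n} {U : Subset n} → T ⊆ U → v ∈ U → T [ v ]≔ inside ⊆ U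
insert-⊆ v {T} T⊆U v∈U w∈ with ∈-insert⁻ T w∈
... | inj₁ refl = v∈U
... | inj₂ w∈T  = T⊆U w∈T

restrict-∣0∣ : ∀ {A : Set} {n} (p : Subset n) → ∣ p ∣ ℕ.≤ 0 → ∃ λ y → ∀ (x : Vec A n) → restrict p x ≡ y
restrict-∣0∣ []            _  = [] , λ { [] → refl }
restrict-∣0∣ (outside ∷ p) le = let y , eq = restrict-∣0∣ p le in y , λ { (_ ∷ x) → eq x }

-- With at most one parent, a conditional table is thus either a constant or a function of a single
-- bit.
restrict-∣1∣ : ∀ {A : Set} {n} (p : Subset n) → ∣ p ∣ ℕ.≤ 1 →
               (∃ λ y → ∀ (x : Vec A n) → restrict p x ≡ y) ⊎
               (∃ λ u → u ∈ p × ∃ λ (y : A → Vec A ∣ p ∣) → ∀ (x : Vec A n) → restrict p x ≡ y (lookup x u))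
restrict-∣1∣ [] _ = inj₁ ([] , λ { [] → refl })
restrict-∣1∣ (inside ∷ p) (ℕ.s≤s le) = let y , eq = restrict-∣0∣ p le in
  inj₂ (zero , here , (_∷ y) , λ { (b ∷ x) → cong (b ∷_) (eq x) })
restrict-∣1∣ (outside ∷ p) le with restrict-∣1∣ p le
... | inj₁ (y , eq)           = inj₁ (y , λ { (_ ∷ x) → eq x })
... | inj₂ (u , u∈p , y , eq) = inj₂ (suc u , there u∈p , y , λ { (_ ∷ x) → eq x })

-- Agreement with an assignment on a set of variables

-- A conjunction with support T whose signs are read off from `a`. Keeping `a` fixed lets the
-- induction vary the support alone.
agree : ∀ {n} → Vec Bool n → Subset n → Vec Bool n → ℝ
agree a T x = ∏[ T ] λ v → literal (lookup a v) (lookup x v)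

-- A function of one bit is affine in either literal of that bit. The freedom in the sign `a` allows
-- the literal to be chosen so that it never conflicts with one already in the conjunction.
literal-interpolates : ∀ (g : Bool → ℝ) a b → g b ≈ g (not a) + (g a - g (not a)) * literal a b
literal-interpolates g true  true  = solve 2 (λ s t → t := s :+ (t :- s) :* con 1ℚ) ≈-refl (g false) (g true)
literal-interpolates g true  false = solve 2 (λ s t → s := s :+ (t :- s) :* con 0ℚ) ≈-refl (g false) (g true)
literal-interpolates g false true  = solve 2 (λ s t → t := t :+ (s :- t) :* (con 1ℚ :- con 1ℚ)) ≈-refl (g false) (g true)
literal-interpolates g false false = solve 2 (λ s t → s := t :+ (s :- t) :* (con 1ℚ :- con 0ℚ)) ≈-refl (g false) (g true)

literal-idem : ∀ a b → literal a b * literal a b ≈ literal a b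
literal-idem true  true  = solve 0 (con 1ℚ :* con 1ℚ := con 1ℚ) ≈-refl
literal-idem true  false = solve 0 (con 0ℚ :* con 0ℚ := con 0ℚ) ≈-refl
literal-idem false true  = solve 0 ((con 1ℚ :- con 1ℚ) :* (con 1ℚ :- con 1ℚ) := con 1ℚ :- con 1ℚ) ≈-refl
literal-idem false false = solve 0 ((con 1ℚ :- con 0ℚ) :* (con 1ℚ :- con 0ℚ) := con 1ℚ :- con 0ℚ) ≈-refl

-- Literals are idempotent, so repeating one that is already present does not enlarge the
-- conjunction.
agree-absorb : ∀ {n} (a : Vec Bool n) {v} {T : Subset n} → v ∈ T → ∀ x →
               literal (lookup a v) (lookup x v) * agree a T x ≈ agree a T x
agree-absorb a {v} {T} v∈T x with remove T v∈T
... | T′ , v∉T′ , refl , _ = begin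
  l * agree a T x           ≈⟨ *-cong ≈-refl expand ⟩
  l * (l * agree a T′ x)    ≈⟨ *-assoc l l (agree a T′ x) ⟨
  (l * l) * agree a T′ x    ≈⟨ *-cong (literal-idem (lookup a v) (lookup x v)) ≈-refl ⟩
  l * agree a T′ x          ≈⟨ expand ⟨
  agree a T x               ∎
  where
  open ≈-Reasoning
  l = literal (lookup a v) (lookup x v)
  expand : agree a T x ≈ l * agree a T′ x
  expand = ∏-insert (λ w → literal (lookup a w) (lookup x w)) v∉T′

-- The bit vector `T₁` itself serves as the assignment: on the union, exactly the members of `T₁`
-- carry positive literals, because disjointness excludes both signs at once.
conjunction≈agree : ∀ {n} (T₁ T₀ : Subset n) → Empty (T₀ ∩ T₁) → ∀ x →
                    conjunction T₁ T₀ x ≈ agree T₁ (T₀ ∪ T₁) x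
conjunction≈agree T₁ T₀ disjoint x = ≈-trans (≈-sym (product-* positive negative)) (product-cong λ v →
  ≈-trans (merge (lookup T₁ v) (lookup T₀ v) (lookup x v)
            λ (v∈T₁ , v∈T₀) → disjoint (v , x∈p∩q⁺ (lookup⇒[]= v T₀ v∈T₀ , lookup⇒[]= v T₁ v∈T₁)))
          (≈-reflexive (cong (λ s → if s then literal (lookup T₁ v) (lookup x v) else 1ℝ)
                  (sym (lookup-zipWith _∨_ v T₀ T₁)))))
  where
  positive negative : Fin _ → ℝ
  positive v = if lookup T₁ v then bit (lookup x v) else 1ℝ
  negative v = if lookup T₀ v then 1ℝ - bit (lookup x v) else 1ℝ
  merge : ∀ t₁ t₀ b → ¬ (t₁ ≡ true × t₀ ≡ true) →
          (if t₁ then bit b else 1ℝ) * (if t₀ then 1ℝ - bit b else 1ℝ) ≈ (if t₀ ∨ t₁ then literal t₁ b else 1ℝ)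
  merge true  true  b ¬both = contradiction (refl , refl) ¬both
  merge true  false b _     = *-identityʳ (bit b)
  merge false true  b _     = *-identityˡ (1ℝ - bit b)
  merge false false b _     = *-identityˡ 1ℝ

1≤^ : ∀ {K} → 1ℝ ≤ K → ∀ m → 1ℝ ≤ K ^ m
1≤^ 1≤K zero = ≤-refl
1≤^ {K} 1≤K (suc m) = begin
  1ℝ          ≲⟨ 1≤K ⟩
  K           ≈⟨ *-identityʳ K ⟨
  K * 1ℝ      ≲⟨ *-monoˡ-≤ (≤-trans 0≤1 1≤K) (1≤^ 1≤K m) ⟩
  K * K ^ m   ∎
  where open ≤-Reasoning

-- Expansions in the basis

module _ {n : ℕ} (D : BayesianNetwork n) where

  open BayesianNetwork D

  -- Expansion U f B says that f is a linear combination of the φ_S with S ⊆ U, whose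
  -- coefficients have absolute values summing to at most B.

  data Expansion (U : Subset n) : (Vec Bool n → ℝ) → ℝ → Set where
    basis-term : ∀ {S} → S ⊆ U → Expansion U (basis S) 1ℝ
    _⊕_    : ∀ {f g A B} → Expansion U f A → Expansion U g B → Expansion U (λ x → f x + g x) (A + B)
    _⊙_    : ∀ {f A} c → Expansion U f A → Expansion U (λ x → c * f x) (abs c * A)
    weaken : ∀ {f g A B} → (∀ x → f x ≈ g x) → A ≤ B → Expansion U f A → Expansion U g B

  coefficient-cong : ∀ {f g} → (∀ x → f x ≈ g x) → ∀ S → coefficient f S ≈ coefficient g S
  coefficient-cong f≈g S = ∑-cong λ x → *-cong ≈-refl (*-cong (f≈g x) ≈-refl)

  coefficient-+ : ∀ f g S → coefficient (λ x → f x + g x) S ≈ coefficient f S + coefficient g S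
  coefficient-+ f g S = ≈-trans
    (∑-cong λ x → solve 4 (λ p a b s → p :* ((a :+ b) :* s) := p :* (a :* s) :+ p :* (b :* s)) ≈-refl
                    (probability x) (f x) (g x) (basis S x))
    (∑-distrib-+ (λ x → probability x * (f x * basis S x)) (λ x → probability x * (g x * basis S x)))

  coefficient-* : ∀ c f S → coefficient (λ x → c * f x) S ≈ c * coefficient f S
  coefficient-* c f S = ≈-trans
    (∑-cong λ x → solve 4 (λ p c a s → p :* ((c :* a) :* s) := c :* (p :* (a :* s))) ≈-refl
                    (probability x) c (f x) (basis S x))
    (∑-distribˡ-* c (λ x → probability x * (f x * basis S x)))

  -- Coefficients are linear in f, so `L₁` is a seminorm, and it is 1 on each basis function by
  -- orthonormality.
  L₁-≤ : ∀ {U f B} → Expansion U f B → L₁ f ≤ B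
  L₁-≤ (basis-term {S} _) = ≈⇒≤ (L₁-basis D S)
  L₁-≤ (_⊕_ {f} {g} {A} {B} e e′) = begin
    L₁ (λ x → f x + g x)
      ≲⟨ ∑-mono (λ S → ≤-trans (≈⇒≤ (abs-cong (coefficient-+ f g S))) (abs-+-≤ (coefficient f S) (coefficient g S))) ⟩
    ∑ (λ S → abs (coefficient f S) + abs (coefficient g S))
      ≈⟨ ∑-distrib-+ (λ S → abs (coefficient f S)) (λ S → abs (coefficient g S)) ⟩
    L₁ f + L₁ g    ≲⟨ +-mono-≤ (L₁-≤ e) (L₁-≤ e′) ⟩
    A + B          ∎
    where open ≤-Reasoning
  L₁-≤ (_⊙_ {f} {A} c e) = begin
    L₁ (λ x → c * f x)
      ≈⟨ ∑-cong (λ S → ≈-trans (abs-cong (coefficient-* c f S)) (abs-* c (coefficient f S))) ⟩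
    ∑ (λ S → abs c * abs (coefficient f S))
      ≈⟨ ∑-distribˡ-* (abs c) (λ S → abs (coefficient f S)) ⟩
    abs c * L₁ f   ≲⟨ *-monoˡ-≤ (0≤abs c) (L₁-≤ e) ⟩
    abs c * A      ∎
    where open ≤-Reasoning
  L₁-≤ (weaken {f} {g} {A} {B} f≈g A≤B e) = begin
    L₁ g   ≈⟨ ∑-cong (λ S → abs-cong (coefficient-cong f≈g S)) ⟨
    L₁ f   ≲⟨ L₁-≤ e ⟩
    A      ≲⟨ A≤B ⟩
    B      ∎
    where open ≤-Reasoning

  Expansion-mono : ∀ {U V f B} → U ⊆ V → Expansion U f B → Expansion V f B
  Expansion-mono U⊆V (basis-term S⊆U)       = basis-term (U⊆V ∘ S⊆U)
  Expansion-mono U⊆V (e ⊕ e′)           = Expansion-mono U⊆V e ⊕ Expansion-mono U⊆V e′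
  Expansion-mono U⊆V (c ⊙ e)            = c ⊙ Expansion-mono U⊆V e
  Expansion-mono U⊆V (weaken f≈g A≤B e) = weaken f≈g A≤B (Expansion-mono U⊆V e)

  -- Multiplication by φ_v maps φ_S to φ_{S ∪ {v}}, so it preserves the coefficients.

  Expansion-φ : ∀ {U v f B} → v ∉ U → Expansion U f B → Expansion (U [ v ]≔ inside) (λ x → φ v x * f x) B
  Expansion-φ {U} {v} v∉U (basis-term {S} S⊆U) = weaken
    (λ x → ∏-insert (λ w → φ w x) (v∉U ∘ S⊆U)) ≤-refl
    (basis-term (insert-⊆ v (⊆-insert v U ∘ S⊆U) (∈-insert-self v U)))
  Expansion-φ {U} {v} v∉U (_⊕_ {f} {g} e e′) = weaken
    (λ x → ≈-sym (*-distribˡ-+ (φ v x) (f x) (g x))) ≤-refl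
    (Expansion-φ v∉U e ⊕ Expansion-φ v∉U e′)
  Expansion-φ {U} {v} v∉U (_⊙_ {f} c e) = weaken
    (λ x → solve 3 (λ c p f → c :* (p :* f) := p :* (c :* f)) ≈-refl c (φ v x) (f x)) ≤-refl
    (c ⊙ Expansion-φ v∉U e)
  Expansion-φ v∉U (weaken f≈g A≤B e) = weaken
    (λ x → *-cong ≈-refl (f≈g x)) A≤B (Expansion-φ v∉U e)

  -- Literals as affine functions of φ_v

  0≤μ : ∀ v y → 0ℝ ≤ μ v y
  0≤μ v y = <⇒≤ (0<μ v y)

  μ≤1 : ∀ v y → μ v y ≤ 1ℝ
  μ≤1 v y = <⇒≤ (μ<1 v y)

  -- Here 1 - μ(1 - μ) = (1 - μ) + μ². The crude bound 1 is the one that means and deviations share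
  -- in `table*agree`.
  σ≤1 : ∀ v y → σ v y ≤ 1ℝ
  σ≤1 v y = x²≤1⇒x≤1 (begin
    σ v y * σ v y            ≈⟨ σ² D v y ⟩
    μ v y * (1ℝ - μ v y)     ≲⟨ ≤-diff ((1ℝ - μ v y) + μ v y * μ v y)
      (solve 1 (λ p → (con 1ℚ :- p) :+ p :* p := con 1ℚ :- p :* (con 1ℚ :- p)) ≈-refl (μ v y))
      (+-nonNeg (x≤y⇒0≤y-x (μ≤1 v y)) (0≤x² (μ v y))) ⟩
    1ℝ                       ∎)
    where open ≤-Reasoning

  -- The coefficient of φ_v in the literal of sign `a` at v, whose constant term is `weight`.
  slope : ∀ v → Bool → Vec Bool ∣ pa v ∣ → ℝ
  slope v a y = if a then σ v y else - σ v y

  abs-weight≤1 : ∀ v a y → abs (weight D v a y) ≤ 1ℝ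
  abs-weight≤1 v true  y = abs≤1 (0≤μ v y) (μ≤1 v y)
  abs-weight≤1 v false y = abs≤1 (x≤y⇒0≤y-x (μ≤1 v y))
    (≤-diff (μ v y) (solve 1 (λ p → p := con 1ℚ :- (con 1ℚ :- p)) ≈-refl (μ v y)) (0≤μ v y))

  abs-slope≤1 : ∀ v a y → abs (slope v a y) ≤ 1ℝ
  abs-slope≤1 v true  y = abs≤1 (0≤sqrt _) (σ≤1 v y)
  abs-slope≤1 v false y = ≤-trans (≈⇒≤ (abs-neg (σ v y))) (abs≤1 (0≤sqrt _) (σ≤1 v y))

  -- The definition of `normalised` solved for the bit gives b = μ + φσ; the negative literal is the
  -- complement.
  literal-normalised : ∀ v a b y → literal a b ≈ weight D v a y + normalised D v b y * slope v a y
  literal-normalised v a b y = go a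
    where
    open ≈-Reasoning
    β = bit b
    p = μ v y
    s = σ v y
    r = recip (σ v y) (0<σ v y)
    go : ∀ a → literal a b ≈ weight D v a y + normalised D v b y * slope v a y
    go true = begin
      β                          ≈⟨ solve 2 (λ β p → β := p :+ (β :- p) :* con 1ℚ) ≈-refl β p ⟩
      p + (β - p) * 1ℝ           ≈⟨ +-cong ≈-refl (*-cong ≈-refl (*-recip s (0<σ v y))) ⟨
      p + (β - p) * (s * r)      ≈⟨ solve 4 (λ β p s r → p :+ (β :- p) :* (s :* r) := p :+ ((β :- p) :* r) :* s) ≈-refl β p s r ⟩
      p + ((β - p) * r) * s      ∎
    go false = begin
      1ℝ - β                         ≈⟨ solve 2 (λ β p → con 1ℚ :- β := (con 1ℚ :- p) :- (β :- p) :* con 1ℚ) ≈-refl β p ⟩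
      (1ℝ - p) - (β - p) * 1ℝ        ≈⟨ +-cong ≈-refl (neg-cong (*-cong ≈-refl (*-recip s (0<σ v y)))) ⟨
      (1ℝ - p) - (β - p) * (s * r)
        ≈⟨ solve 4 (λ β p s r → (con 1ℚ :- p) :- (β :- p) :* (s :* r) := (con 1ℚ :- p) :+ ((β :- p) :* r) :* (:- s)) ≈-refl β p s r ⟩
      (1ℝ - p) + ((β - p) * r) * (- s) ∎

  literal-expansion : ∀ v a x → literal a (lookup x v) ≈
                      weight D v a (restrict (pa v) x) + φ v x * slope v a (restrict (pa v) x)
  literal-expansion v a x = ≈-trans (literal-normalised v a (lookup x v) (restrict (pa v) x))
    (+-cong ≈-refl (*-cong (≈-sym (φ≈normalised D v x)) ≈-refl))

  -- Eliminating sinks, at the cost of a factor K per literal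

  module _ (α K : ℝ) (0≤α : 0ℝ ≤ α) (1≤K : 1ℝ ≤ K) (2+2αK≤K : 2ℝ + 2ℝ * α * K ≤ K)
           (∣pa∣≤1 : ∀ v → ∣ pa v ∣ ℕ.≤ 1) (bounded : DifferenceBounded α) (a : Vec Bool n) where

    weight-bounded : ∀ v s y z → abs (weight D v s y - weight D v s z) ≤ α
    weight-bounded v true  y z = proj₁ (bounded v y z)
    weight-bounded v false y z = ≤-trans (≈⇒≤ (≈-trans
      (abs-cong (solve 2 (λ p q → (con 1ℚ :- p) :- (con 1ℚ :- q) := :- (p :- q)) ≈-refl (μ v y) (μ v z)))
      (abs-neg (μ v y - μ v z)))) (proj₁ (bounded v y z))

    slope-bounded : ∀ v s y z → abs (slope v s y - slope v s z) ≤ α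
    slope-bounded v true  y z = proj₂ (bounded v y z)
    slope-bounded v false y z = ≤-trans (≈⇒≤ (≈-trans
      (abs-cong (solve 2 (λ p q → (:- p) :- (:- q) := :- (p :- q)) ≈-refl (σ v y) (σ v z)))
      (abs-neg (σ v y - σ v z)))) (proj₂ (bounded v y z))

    0≤K^ : ∀ m → 0ℝ ≤ K ^ m
    0≤K^ m = ≤-trans 0≤1 (1≤^ 1≤K m)

    K^-step : ∀ m → K ^ m ≤ K ^ suc m
    K^-step m = ≤-trans (≈⇒≤ (≈-sym (*-identityˡ (K ^ m)))) (*-monoʳ-≤ (0≤K^ m) 1≤K)

    -- `agree-U` is the induction hypothesis of `agree-expansion`.
    module _ (U : Subset n) (agree-U : ∀ T → T ⊆ U → Expansion U (agree a T) (K ^ ∣ T ∣)) where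

      -- Either the literal is absorbed, and K ≥ 1 gives the slack, or the support grows by one
      -- variable.
      literal*agree : ∀ u T → u ∈ U → T ⊆ U →
                      Expansion U (λ x → literal (lookup a u) (lookup x u) * agree a T x) (K ^ suc ∣ T ∣)
      literal*agree u T u∈U T⊆U with u ∈? T
      ... | yes u∈T = weaken (λ x → ≈-sym (agree-absorb a u∈T x)) (K^-step ∣ T ∣) (agree-U T T⊆U)
      ... | no  u∉T = weaken
        (λ x → ∏-insert (λ w → literal (lookup a w) (lookup x w)) u∉T)
        (≈⇒≤ (≈-reflexive (cong (K ^_) (∣insert∣ T u∉T))))
        (agree-U (T [ u ]≔ inside) (insert-⊆ u T⊆U u∈U))

      -- Interpolating h in the parent's literal of sign `lookup a u` leaves a constant of size at
      -- most 1 and a difference of size at most α; only the difference meets the extra literal. For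
      -- a constant table the second summand is slack.
      table*agree : ∀ v (h : Vec Bool ∣ pa v ∣ → ℝ) → (∀ y → abs (h y) ≤ 1ℝ) → (∀ y z → abs (h y - h z) ≤ α) →
                    ∀ T → pa v ⊆ U → T ⊆ U →
                    Expansion U (λ x → h (restrict (pa v) x) * agree a T x) (K ^ ∣ T ∣ + α * K ^ suc ∣ T ∣)
      table*agree v h h≤1 h-α T pa⊆U T⊆U with restrict-∣1∣ (pa v) (∣pa∣≤1 v)
      ... | inj₁ (y , eq) = weaken
        (λ x → *-cong (≈-reflexive (cong h (sym (eq x)))) ≈-refl)
        (begin
          abs (h y) * K ^ ∣ T ∣              ≲⟨ *-monoʳ-≤ (0≤K^ ∣ T ∣) (h≤1 y) ⟩
          1ℝ * K ^ ∣ T ∣                     ≈⟨ solve 1 (λ k → con 1ℚ :* k := k :+ con 0ℚ) ≈-refl (K ^ ∣ T ∣) ⟩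
          K ^ ∣ T ∣ + 0ℝ                     ≲⟨ +-mono-≤ ≤-refl (*-nonNeg 0≤α (0≤K^ (suc ∣ T ∣))) ⟩
          K ^ ∣ T ∣ + α * K ^ suc ∣ T ∣      ∎)
        (h y ⊙ agree-U T T⊆U)
        where open ≤-Reasoning
      ... | inj₂ (u , u∈pa , y , eq) = weaken interpolate
        (+-mono-≤
          (≤-trans (*-monoʳ-≤ (0≤K^ ∣ T ∣) (h≤1 (y (not b)))) (≈⇒≤ (*-identityˡ (K ^ ∣ T ∣))))
          (*-monoʳ-≤ (0≤K^ (suc ∣ T ∣)) (h-α (y b) (y (not b)))))
        ((h (y (not b)) ⊙ agree-U T T⊆U) ⊕
         ((h (y b) - h (y (not b))) ⊙ literal*agree u T (pa⊆U u∈pa) T⊆U))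
        where
        open ≈-Reasoning
        b = lookup a u
        interpolate : ∀ x → h (y (not b)) * agree a T x
                              + (h (y b) - h (y (not b))) * (literal b (lookup x u) * agree a T x)
                          ≈ h (restrict (pa v) x) * agree a T x
        interpolate x = begin
          s * g + (t - s) * (l * g)   ≈⟨ solve 4 (λ s t l g → s :* g :+ (t :- s) :* (l :* g) := (s :+ (t :- s) :* l) :* g) ≈-refl s t l g ⟩
          (s + (t - s) * l) * g       ≈⟨ *-cong (literal-interpolates (h ∘ y) b (lookup x u)) ≈-refl ⟨
          h (y (lookup x u)) * g      ≡⟨ cong (λ z → h z * g) (eq x) ⟨
          h (restrict (pa v) x) * g   ∎
          where
          s = h (y (not b))
          t = h (y b)
          l = literal b (lookup x u)
          g = agree a T x

    -- Induction on the topological order. If the last variable v is in T, its literal is a weight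
    -- plus φ_v times a slope. Both tables depend only on variables in U, so the hypothesis applies
    -- to them, and multiplying by φ_v is then free.
    agree-expansion : ∀ {U} → AncestorClosed D U → ∀ T → T ⊆ U → Expansion U (agree a T) (K ^ ∣ T ∣)
    agree-expansion empty T T⊆⊥ with ⊆-antisym T⊆⊥ ⊥⊆
    -- Both the empty conjunction and `basis ⊥` are empty products.
    ... | refl = weaken
      (λ x → ≈-trans (∏-⊥ (λ v → φ v x)) (≈-sym (∏-⊥ (λ v → literal (lookup a v) (lookup x v)))))
      (1≤^ 1≤K ∣ ⊥ {n} ∣) (basis-term ⊥⊆)
    agree-expansion (insert {U} {v} cl v∉U pa⊆U) T T⊆ with v ∈? T
    ... | no v∉T = Expansion-mono (⊆-insert v U) (agree-expansion cl T (⊆-insert⁻ U v∉T T⊆))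
    ... | yes v∈T with remove T v∈T
    ...   | T′ , v∉T′ , refl , T′⊆T = weaken expand bound
      (Expansion-mono (⊆-insert v U)
        (table v (weight D v b) (abs-weight≤1 v b) (weight-bounded v b) T′ pa⊆U T′⊆U)
       ⊕ Expansion-φ v∉U
        (table v (slope v b) (abs-slope≤1 v b) (slope-bounded v b) T′ pa⊆U T′⊆U))
      where
      b = lookup a v
      table = table*agree U (agree-expansion cl)
      T′⊆U : T′ ⊆ U
      T′⊆U = ⊆-insert⁻ U v∉T′ (T⊆ ∘ T′⊆T)

      expand : ∀ x → weight D v b (restrict (pa v) x) * agree a T′ x
                       + φ v x * (slope v b (restrict (pa v) x) * agree a T′ x)
                   ≈ agree a (T′ [ v ]≔ inside) x
      expand x = begin
        m * g + f * (s * g)             ≈⟨ solve 4 (λ m f s g → m :* g :+ f :* (s :* g) := (m :+ f :* s) :* g) ≈-refl m f s g ⟩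
        (m + f * s) * g                 ≈⟨ *-cong (literal-expansion v b x) ≈-refl ⟨
        literal b (lookup x v) * g      ≈⟨ ∏-insert (λ w → literal (lookup a w) (lookup x w)) v∉T′ ⟨
        agree a (T′ [ v ]≔ inside) x    ∎
        where
        open ≈-Reasoning
        m = weight D v b (restrict (pa v) x)
        s = slope v b (restrict (pa v) x)
        f = φ v x
        g = agree a T′ x

      -- The two equal summands come from the weight and the slope; together they are (2 + 2αK)
      -- K^∣T′∣, which explains the condition on K.
      bound : (K ^ ∣ T′ ∣ + α * K ^ suc ∣ T′ ∣) + (K ^ ∣ T′ ∣ + α * K ^ suc ∣ T′ ∣) ≤ K ^ ∣ T′ [ v ]≔ inside ∣
      bound = begin
        (k + α * (K * k)) + (k + α * (K * k))
          ≈⟨ solve 3 (λ k α K → (k :+ α :* (K :* k)) :+ (k :+ α :* (K :* k))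
                       := (con (1ℚ ℚ.+ 1ℚ) :+ con (1ℚ ℚ.+ 1ℚ) :* α :* K) :* k) ≈-refl k α K ⟩
        (2ℝ + 2ℝ * α * K) * k        ≲⟨ *-monoʳ-≤ (0≤K^ ∣ T′ ∣) 2+2αK≤K ⟩
        K * k                        ≡⟨ cong (K ^_) (∣insert∣ T′ v∉T′) ⟨
        K ^ ∣ T′ [ v ]≔ inside ∣     ∎
        where
        open ≤-Reasoning
        k = K ^ ∣ T′ ∣

-- The admissible constant K = ((2 - 2α)/(1 - 2α))²

module _ (α : ℝ) (α<½ : α < ½ℝ) where

  open ≈-Reasoning

  private
    u = 1ℝ - 2ℝ * α
    r = recip u (x<½⇒0<1-2x α α<½)

    0≤u : 0ℝ ≤ u
    0≤u = <⇒≤ (x<½⇒0<1-2x α α<½)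

    0≤r : 0ℝ ≤ r
    0≤r = 0≤recip u (x<½⇒0<1-2x α α<½)

    ur≈1 : u * r ≈ 1ℝ
    ur≈1 = *-recip u (x<½⇒0<1-2x α α<½)

  base : ℝ
  base = (2ℝ - 2ℝ * α) / (1ℝ - 2ℝ * α) [ x<½⇒0<1-2x α α<½ ]

  -- Since 2 - 2α = (1 - 2α) + 1, the base is 1 + r with r = 1/(1 - 2α).
  base² : base ^ 2 ≈ (1ℝ + r) * (1ℝ + r)
  base² = begin
    base * (base * 1ℝ)     ≈⟨ *-cong base≈1+r (*-cong base≈1+r ≈-refl) ⟩
    (1ℝ + r) * ((1ℝ + r) * 1ℝ)  ≈⟨ *-cong ≈-refl (*-identityʳ (1ℝ + r)) ⟩
    (1ℝ + r) * (1ℝ + r)    ∎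
    where
    base≈1+r : base ≈ 1ℝ + r
    base≈1+r = begin
      (2ℝ - 2ℝ * α) * r    ≈⟨ solve 2 (λ α r → (con (1ℚ ℚ.+ 1ℚ) :- con (1ℚ ℚ.+ 1ℚ) :* α) :* r
                                  := (con 1ℚ :- con (1ℚ ℚ.+ 1ℚ) :* α) :* r :+ r) ≈-refl α r ⟩
      u * r + r            ≈⟨ +-cong ur≈1 ≈-refl ⟩
      1ℝ + r               ∎

  1≤base² : 1ℝ ≤ base ^ 2
  1≤base² = ≤-trans
    (≤-diff (r + r + r * r)
      (solve 1 (λ r → r :+ r :+ r :* r := (con 1ℚ :+ r) :* (con 1ℚ :+ r) :- con 1ℚ) ≈-refl r)
      (+-nonNeg (+-nonNeg 0≤r 0≤r) (0≤x² r)))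
    (≈⇒≤ (≈-sym base²))

  -- With u = 1 - 2α and r = 1/u, the difference K - 2 - 2αK = uK - 2 is u + r at K = (1 + r)².

  2+2α*base²≤base² : 2ℝ + 2ℝ * α * base ^ 2 ≤ base ^ 2
  2+2α*base²≤base² = ≤-trans (≈⇒≤ (+-cong ≈-refl (*-cong ≈-refl base²)))
    (≤-trans (≤-diff (u + r) gap (+-nonNeg 0≤u 0≤r)) (≈⇒≤ (≈-sym base²)))
    where
    gap : u + r ≈ (1ℝ + r) * (1ℝ + r) - (2ℝ + 2ℝ * α * ((1ℝ + r) * (1ℝ + r)))
    gap = begin
      u + r
        ≈⟨ solve 2 (λ u r → u :+ r := u :+ con (1ℚ ℚ.+ 1ℚ) :* con 1ℚ :+ con 1ℚ :* r :- con (1ℚ ℚ.+ 1ℚ)) ≈-refl u r ⟩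
      u + 2ℝ * 1ℝ + 1ℝ * r - 2ℝ
        ≈⟨ +-cong (+-cong (+-cong ≈-refl (*-cong ≈-refl ur≈1)) (*-cong ur≈1 ≈-refl)) ≈-refl ⟨
      u + 2ℝ * (u * r) + u * r * r - 2ℝ
        ≈⟨ solve 2 (λ α r → let two = con (1ℚ ℚ.+ 1ℚ) ; u = con 1ℚ :- two :* α ; k = (con 1ℚ :+ r) :* (con 1ℚ :+ r) in
             u :+ two :* (u :* r) :+ u :* r :* r :- two := k :- (two :+ two :* α :* k)) ≈-refl α r ⟩
      (1ℝ + r) * (1ℝ + r) - (2ℝ + 2ℝ * α * ((1ℝ + r) * (1ℝ + r))) ∎

mainTheorem7 : ∀ (n : ℕ) (α : ℝ) → 0ℝ ≤ α → (α<½ : α < ½ℝ) →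
    (D : BayesianNetwork n) → BayesianNetwork.IsTree D → BayesianNetwork.DifferenceBounded D α →
    ∀ (d : ℕ) (T₁ T₀ : Subset n) → Empty (T₀ ∩ T₁) → ∣ T₀ ∪ T₁ ∣ ≡ d →
    BayesianNetwork.L₁ D (conjunction T₁ T₀)
    ≤ ((2ℝ - 2ℝ * α) / (1ℝ - 2ℝ * α) [ x<½⇒0<1-2x α α<½ ]) ^ (2 ℕ.* d)
mainTheorem7 n α 0≤α α<½ D (∣pa∣≤1 , _) bounded d T₁ T₀ disjoint refl = L₁-≤ D
  (weaken (λ x → ≈-sym (conjunction≈agree T₁ T₀ disjoint x))
    -- The expansion is bounded by K^d with K = `base ^ 2`, which is the base to the power 2d.
    (≈⇒≤ (Exp.^-assocʳ (CommutativeRing.semiring ℝ-commutativeRing) (base α α<½) 2 d))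
    (agree-expansion D α (base α α<½ ^ 2) 0≤α (1≤base² α α<½) (2+2α*base²≤base² α α<½)
      ∣pa∣≤1 bounded T₁ (⊤-ancestorClosed D) (T₀ ∪ T₁) ⊆⊤))
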